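{- Let $\Gamma$ be a commutative quasi-thin weakly distance-regular digraph of valency more than $3$, let $q\geq3$ and $(1,q-1)\in\tilde\partial(\Gamma)$. (i) If $p^{(1,q-1)}_{(1,s-1),(1,t-1)}\neq0$ for some $(1,s-1),(1,t-1)\in\tilde\partial(\Gamma)$ with $s<t$, then $s=2$ and $t=q$. (ii) The following are equivalent: (a) $(1,q-1)$ is mixed; (b) $p^{(1,q-2)}_{(1,q-1),(1,q-1)}\neq0$ and $(1,q-2)$ is pure; (c) $p^{(1,s-1)}_{(1,q-1),(1,q-1)}\neq0$ for some $s$ with $(1,s-1)\in\tilde\partial(\Gamma)$. (iii) If $p^{(1,s-1)}_{(1,q-1),(1,q-1)}\neq0$, then $s=q-1$.
   Context: All digraphs are finite and simple. $\partial(x,y)$ is the length of a shortest directed path from $x$ to $y$, $\tilde\partial(x,y)=(\partial(x,y),\partial(y,x))$, $\tilde\partial(\Gamma)=\{\tilde\partial(x,y)\}$. A strongly connected digraph is weakly distance-regular if for all $\tilde h,\tilde i,\tilde j\in\tilde\partial(\Gamma)$ the number $p^{\tilde h}_{\tilde i,\tilde j}=|\{z\mid\tilde\partial(x,z)=\tilde i,\tilde\partial(z,y)=\tilde j\}|$ depends only on $\tilde h=\tilde\partial(x,y)$; $k_{\tilde i}=|\{y\mid\tilde\partial(x,y)=\tilde i\}|$; valency $=\sum_{(1,j)\in\tilde\partial(\Gamma)}k_{(1,j)}$. Commutative: $p^{\tilde h}_{\tilde i,\tilde j}=p^{\tilde h}_{\tilde j,\tilde i}$; quasi-thin: maximum intersection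 number is $2$. An arc $(u,v)$ is of type $(1,r)$ if $\partial(v,u)=r$. A path $(w_0,\dots,w_{r-1})$ is a circuit of length $r$ if $\partial(w_{r-1},w_0)=1$. An arc of type $(1,q-1)$ is pure if every circuit of length $q$ containing it consists of arcs of type $(1,q-1)$, mixed otherwise; $(1,q-1)$ is pure if all its arcs are pure, mixed otherwise. Statements like "$p^{\tilde h}_{\tilde i,\tilde j}\neq0$" or "$(1,r)$ is pure" presuppose that the indices lie in $\tilde\partial(\Gamma)$. -}

module Defs where

open import Data.Nat using (ℕ; zero; suc; _+_; _∸_; _<_; _≤_; _<?_; _≡ᵇ_)
open import Data.Fin using (Fin; zero; suc; toℕ; fromℕ<; _≟_)
open import Data.Bool using (Bool; true; false; if_then_else_; _∧_; _∨_; T)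
open import Data.Product using (Σ; ∃; _×_; _,_; proj₁; proj₂)
open import Relation.Nullary using (¬_; yes; no)
open import Relation.Nullary.Decidable using (⌊_⌋)
open import Relation.Binary.PropositionalEquality using (_≡_)
open import Function.Definitions using (Injective)

record Digraph : Set where
  field
    n     : ℕ
    Adj   : Fin n → Fin n → Bool
    loopless : ∀ x → Adj x x ≡ false

anyFin : ∀ m → (Fin m → Bool) → Bool
anyFin zero    p = false
anyFin (suc m) p = p zero ∨ anyFin m (λ i → p (suc i))

countFin : ∀ m → (Fin m → Bool) → ℕ
countFin zero    p = 0
countFin (suc m) p = (if p zero then 1 else 0) + countFin m (λ i → p (suc i))

leastBelow : (ℕ → Bool) → ℕ → ℕ
leastBelow p zero    = zero
leastBelow p (suc m) = if p 0 then 0 else suc (leastBelow (λ k → p (suc k)) m)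

next : ∀ {m} → Fin (suc m) → Fin (suc m)
next {m} i with suc (toℕ i) <? suc m
... | yes p = fromℕ< p
... | no _  = zero

_=ᵖ_ : ℕ × ℕ → ℕ × ℕ → Bool
(a , b) =ᵖ (c , d) = (a ≡ᵇ c) ∧ (b ≡ᵇ d)

module _ (Γ : Digraph) where
  open Digraph Γ

  V : Set
  V = Fin n

  walk : ℕ → V → V → Bool
  walk zero    x y = ⌊ x ≟ y ⌋
  walk (suc k) x y = anyFin n (λ z → Adj x z ∧ walk k z y)

  StronglyConnected : Set
  StronglyConnected = ∀ x y → ∃ λ k → T (walk k x y)

  -- ∂(x,y): length of a shortest directed path (= shortest walk) from x to y.
  -- A shortest walk has length < n; the value n is a default used only
  -- when y is unreachable (never the case in a strongly connected digraph).
  ∂ : V → V → ℕ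
  ∂ x y = leastBelow (λ k → walk k x y) n

  ∂̃ : V → V → ℕ × ℕ
  ∂̃ x y = (∂ x y , ∂ y x)

  InD : ℕ × ℕ → Set
  InD i = ∃ λ x → ∃ λ y → ∂̃ x y ≡ i

  pxy : V → V → ℕ × ℕ → ℕ × ℕ → ℕ
  pxy x y i j = countFin n (λ z → (∂̃ x z =ᵖ i) ∧ (∂̃ z y =ᵖ j))

  WeaklyDistanceRegular : Set
  WeaklyDistanceRegular =
    StronglyConnected ×
    (∀ i j → InD i → InD j → ∀ x y x' y' → ∂̃ x y ≡ ∂̃ x' y' →
       pxy x y i j ≡ pxy x' y' i j)

  -- p^h_{i,j} ≠ 0  (h presupposed in ∂̃(Γ): witnessed by x, y)
  PNonzero : ℕ × ℕ → ℕ × ℕ → ℕ × ℕ → Set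
  PNonzero h i j = InD i × InD j × (∃ λ x → ∃ λ y → ∂̃ x y ≡ h × 0 < pxy x y i j)

  Commutative : Set
  Commutative = ∀ i j → InD i → InD j → ∀ x y → pxy x y i j ≡ pxy x y j i

  QuasiThin : Set
  QuasiThin =
    (∀ i j → InD i → InD j → ∀ x y → pxy x y i j ≤ 2) ×
    (∃ λ i → ∃ λ j → InD i × InD j × ∃ λ x → ∃ λ y → pxy x y i j ≡ 2)

  -- valency at x: Σ_{(1,j) ∈ ∂̃(Γ)} k_{(1,j)} = |{y | ∂(x,y) = 1}|
  valency : V → ℕ
  valency x = countFin n (λ y → ∂ x y ≡ᵇ 1)

  IsCircuit : ∀ {m} → (Fin (suc m) → V) → Set
  IsCircuit w = Injective _≡_ _≡_ w × (∀ i → ∂ (w i) (w (next i)) ≡ 1)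

  ContainsArc : ∀ {m} → (Fin (suc m) → V) → V → V → Set
  ContainsArc w u v = ∃ λ i → w i ≡ u × w (next i) ≡ v

  Pure : ℕ → Set
  Pure r = ∀ u v → ∂ u v ≡ 1 → ∂ v u ≡ r →
           (w : Fin (suc r) → V) → IsCircuit w → ContainsArc w u v →
           ∀ i → ∂ (w (next i)) (w i) ≡ r

  Mixed : ℕ → Set
  Mixed r = ¬ Pure r

{-# OPTIONS --safe #-}
module Submission where

open import Defs hiding (V)
open import Data.Nat hiding (_/_; _%_)
open import Data.Nat.DivMod using (_/_; _%_; m≡m%n+[m/n]*n; m%n<n)
open import Data.Nat.Properties
open import Data.Bool using (Bool; true; false; T; _∧_)
open import Data.Bool.Properties using (T-≡; T-∧; T-∨)
open import Data.Fin using (Fin; zero; suc; toℕ)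
import Data.Fin as Fin
open import Data.Fin.Properties using (any?; injective⇒≤; toℕ-fromℕ<; toℕ-injective; toℕ<n)
import Data.Fin.Properties as Fin
open import Data.Product hiding (swap)
open import Data.Product.Properties using (≡-dec)
open import Data.Sum using (_⊎_; inj₁; inj₂; [_,_]′)
open import Data.Empty using (⊥; ⊥-elim)
open import Data.List using (List; []; _∷_; _++_; length; replicate)
open import Data.List.Properties using (length-++; length-replicate; ++-identityʳ)
open import Data.List.Relation.Unary.All using (All; []; _∷_)
import Data.List.Relation.Unary.All as All
open import Data.List.Relation.Unary.All.Properties using (replicate⁺; ++⁺)
open import Data.List.Relation.Unary.Any using (here; there)
open import Data.List.Membership.Propositional using (_∈_)
open import Data.List.Membership.Propositional.Properties using (∈-++⁺ʳ)
open import Data.List.Relation.Binary.Permutation.Propositional using (_↭_; ↭-sym; prep; swap)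
import Data.List.Relation.Binary.Permutation.Propositional as ↭
open import Data.List.Relation.Binary.Permutation.Propositional.Properties
  using (shift; ++-comm; ↭-length; All-resp-↭; ∈-resp-↭; drop-∷)
open import Function using (_∘_; case_of_)
open import Function.Bundles using (_⇔_; mk⇔; Equivalence)
open import Function.Definitions using (Injective)
open import Relation.Nullary
open import Relation.Nullary.Decidable using (toWitness; fromWitness; _×-dec_; ¬?; decidable-stable)
open import Relation.Binary.Definitions using (Tri; tri<; tri≈; tri>)
open import Relation.Binary.PropositionalEquality

-- Write r for the arc type (1 , r).  By commutativity and regularity the arc types along a closed
-- walk may be permuted and the walk may be started anywhere, and a closed walk through an arc of
-- type r has at least r + 1 arcs.  If it has exactly r + 1 arcs, the distances between the ends of
-- two consecutive arcs are forced, so that pairs of consecutive types with the same forced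
-- distances can be exchanged for one another.  Since all valencies are at most 2, such exchanges
-- show, by induction on r, that a closed walk of r + 1 arcs through an arc of type r either has all
-- its arcs of type r, or consists of two arcs of type r, which span an arc of type r ∸ 1, and of
-- arcs of the pure type r ∸ 1.  The walks with one arc of type r and r arcs of a smaller type e
-- resist the exchanges; there the square of e contains a thin relation, and the
-- translation by it turns the walks of arcs of type e into a lattice with short periods.
-- This description of circuits gives (ii); for (iii) one compares the two relations in the square
-- of r, one of which is thin, and (i) follows by a further exchange for the relation (2 , r).

-- On a closed walk of r + 1 arcs the return distance across two consecutive arcs, one of them of
-- type r, is always forced. The forward distance is forced to be 2 only if a further arc of type r
-- lies in the rest of the walk; otherwise a chord may shorten the walk without contradiction. Hence
-- the number of arcs of type r matters, and a single one is the hard case: chords must be excluded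
-- separately before all other types can be made equal to one e < r. The resulting walk has nothing
-- left to exchange. What helps is that of two distinct relations in the square of a relation of
-- valency at most 2 one is thin; its translation is an automorphism that bends arcs of type e into
-- arcs of type e, so that walks close up too early. That an arc type in the square of r is r - 1 is
-- already needed inside the induction, so it is proved for types below a bound.

anyFin⁺ : ∀ {m} (p : Fin m → Bool) i → T (p i) → T (anyFin m p)
anyFin⁺ p zero    t = Equivalence.from T-∨ (inj₁ t)
anyFin⁺ p (suc i) t = Equivalence.from (T-∨ {p zero}) (inj₂ (anyFin⁺ (p ∘ suc) i t))

anyFin⁻ : ∀ {m} (p : Fin m → Bool) → T (anyFin m p) → ∃ λ i → T (p i)
anyFin⁻ {suc m} p t with Equivalence.to (T-∨ {p zero}) t
... | inj₁ t₀ = zero , t₀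
... | inj₂ t₁ with anyFin⁻ (p ∘ suc) t₁
...   | i , tᵢ = suc i , tᵢ

count-cons : ∀ {m} (p : Fin (suc m) → Bool) → T (p zero) →
             countFin (suc m) p ≡ suc (countFin m (p ∘ suc))
count-cons p t rewrite Equivalence.to T-≡ t = refl

count-tail : ∀ {m} (p : Fin (suc m) → Bool) → countFin m (p ∘ suc) ≤ countFin (suc m) p
count-tail p = m≤n+m _ _

count≥1 : ∀ {m} (p : Fin m → Bool) i → T (p i) → 1 ≤ countFin m p
count≥1 p zero    t rewrite count-cons p t = s≤s z≤n
count≥1 p (suc i) t = ≤-trans (count≥1 (p ∘ suc) i t) (count-tail p)

count≥2 : ∀ {m} (p : Fin m → Bool) i j → i ≢ j → T (p i) → T (p j) → 2 ≤ countFin m p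
count≥2 p zero    zero    i≢j s t = ⊥-elim (i≢j refl)
count≥2 p zero    (suc j) i≢j s t rewrite count-cons p s = s≤s (count≥1 (p ∘ suc) j t)
count≥2 p (suc i) zero    i≢j s t rewrite count-cons p t = s≤s (count≥1 (p ∘ suc) i s)
count≥2 p (suc i) (suc j) i≢j s t =
  ≤-trans (count≥2 (p ∘ suc) i j (i≢j ∘ cong suc) s t) (count-tail p)

count≥3 : ∀ {m} (p : Fin m → Bool) i j k → i ≢ j → i ≢ k → j ≢ k →
          T (p i) → T (p j) → T (p k) → 3 ≤ countFin m p
count≥3 p zero    zero    k       ij ik jk s t u = ⊥-elim (ij refl)
count≥3 p zero    (suc j) zero    ij ik jk s t u = ⊥-elim (ik refl)
count≥3 p zero    (suc j) (suc k) ij ik jk s t u rewrite count-cons p s =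
  s≤s (count≥2 (p ∘ suc) j k (jk ∘ cong suc) t u)
count≥3 p (suc i) zero    zero    ij ik jk s t u = ⊥-elim (jk refl)
count≥3 p (suc i) zero    (suc k) ij ik jk s t u rewrite count-cons p t =
  s≤s (count≥2 (p ∘ suc) i k (ik ∘ cong suc) s u)
count≥3 p (suc i) (suc j) zero    ij ik jk s t u rewrite count-cons p u =
  s≤s (count≥2 (p ∘ suc) i j (ij ∘ cong suc) s t)
count≥3 p (suc i) (suc j) (suc k) ij ik jk s t u =
  ≤-trans (count≥3 (p ∘ suc) i j k (ij ∘ cong suc) (ik ∘ cong suc) (jk ∘ cong suc) s t u) (count-tail p)

count≥1⁻ : ∀ {m} (p : Fin m → Bool) → 1 ≤ countFin m p → ∃ λ i → T (p i)
count≥1⁻ {suc m} p c with p zero in eq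
... | true  = zero , Equivalence.from T-≡ eq
... | false with count≥1⁻ (p ∘ suc) c
...   | i , t = suc i , t

count≥2⁻ : ∀ {m} (p : Fin m → Bool) → 2 ≤ countFin m p →
           ∃ λ i → ∃ λ j → i ≢ j × T (p i) × T (p j)
count≥2⁻ {suc m} p c with p zero in eq
... | true with count≥1⁻ (p ∘ suc) (s≤s⁻¹ c)
...   | j , t = zero , suc j , (λ ()) , Equivalence.from T-≡ eq , t
count≥2⁻ {suc m} p c | false with count≥2⁻ (p ∘ suc) c
...   | i , j , i≢j , s , t = suc i , suc j , i≢j ∘ Fin.suc-injective , s , t

=ᵖ⁺ : ∀ {a b} → a ≡ b → T (a =ᵖ b)
=ᵖ⁺ {a , b} refl = Equivalence.from (T-∧ {a ≡ᵇ a}) (≡⇒≡ᵇ a a refl , ≡⇒≡ᵇ b b refl)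

=ᵖ⁻ : ∀ {a b} → T (a =ᵖ b) → a ≡ b
=ᵖ⁻ {a , b} {c , d} t with Equivalence.to (T-∧ {a ≡ᵇ c}) t
... | s , u = cong₂ _,_ (≡ᵇ⇒≡ a c s) (≡ᵇ⇒≡ b d u)

leastBelow-≤ : ∀ (p : ℕ → Bool) m k → T (p k) → leastBelow p m ≤ k
leastBelow-≤ p zero    k t = z≤n
leastBelow-≤ p (suc m) k t with p 0 in eq
... | true = z≤n
leastBelow-≤ p (suc m) zero    t | false = ⊥-elim (subst T eq t)
leastBelow-≤ p (suc m) (suc k) t | false = s≤s (leastBelow-≤ (p ∘ suc) m k t)

leastBelow-T : ∀ (p : ℕ → Bool) m k → k < m → T (p k) → T (p (leastBelow p m))
leastBelow-T p (suc m) k k<m t with p 0 in eq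
... | true = Equivalence.from T-≡ eq
leastBelow-T p (suc m) zero    k<m t | false = ⊥-elim (subst T eq t)
leastBelow-T p (suc m) (suc k) k<m t | false = leastBelow-T (p ∘ suc) m k (s≤s⁻¹ k<m) t

-- Distances in a strongly connected digraph

module Distance (Γ : Digraph) (sc : StronglyConnected Γ) where
  open Digraph Γ

  record Walk (k : ℕ) (x y : Fin n) : Set where
    constructor mk
    field holds : T (walk Γ k x y)
  open Walk

  walk-∷ : ∀ {k x y z} → T (Adj x z) → Walk k z y → Walk (suc k) x y
  walk-∷ {x = x} {z = z} a (mk t) = mk (anyFin⁺ _ z (Equivalence.from (T-∧ {Adj x z}) (a , t)))

  walk-∷⁻ : ∀ {k x y} → Walk (suc k) x y → ∃ λ z → T (Adj x z) × Walk k z y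
  walk-∷⁻ {x = x} (mk t) with anyFin⁻ _ t
  ... | z , s with Equivalence.to (T-∧ {Adj x z}) s
  ...   | a , u = z , a , mk u

  walk-refl : ∀ x → Walk 0 x x
  walk-refl x = mk (fromWitness {a? = x Fin.≟ x} refl)

  walk-0 : ∀ {x y} → Walk 0 x y → x ≡ y
  walk-0 (mk t) = toWitness t

  walk-++ : ∀ {k l x y z} → Walk k x y → Walk l y z → Walk (k + l) x z
  walk-++ {zero} t u with walk-0 t
  ... | refl = u
  walk-++ {suc k} t u with walk-∷⁻ t
  ... | v , a , t′ = walk-∷ a (walk-++ t′ u)

  -- The search bound comes from the walk that strong connectivity provides, so the default value of
  -- `leastBelow` never occurs. `∂` searches only below `n`; `δ` serves to show that this is far
  -- enough.
  δ : Fin n → Fin n → ℕ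
  δ x y = leastBelow (λ k → walk Γ k x y) (suc (proj₁ (sc x y)))

  δ-walk : ∀ x y → Walk (δ x y) x y
  δ-walk x y = mk (leastBelow-T (λ k → walk Γ k x y) (suc (proj₁ (sc x y))) (proj₁ (sc x y)) ≤-refl (proj₂ (sc x y)))

  δ-≤ : ∀ {k x y} → Walk k x y → δ x y ≤ k
  δ-≤ {k} {x} {y} (mk t) = leastBelow-≤ (λ k → walk Γ k x y) (suc (proj₁ (sc x y))) k t

  δ-step : ∀ {k x y} → δ x y ≡ suc k → ∃ λ z → δ z y ≡ k
  δ-step {k} {x} {y} eq with walk-∷⁻ (subst (λ m → Walk m x y) eq (δ-walk x y))
  ... | z , a , t = z , ≤-antisym (δ-≤ t)
        (s≤s⁻¹ (subst (_≤ suc (δ z y)) eq (δ-≤ (walk-∷ a (δ-walk z y)))))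

  δ-level : ∀ {x y} m i → δ x y ≡ m → i ≤ m → ∃ λ z → δ z y ≡ i
  δ-level {x} m i eq i≤ with i ≟ m
  ... | yes i≡m = x , trans eq (sym i≡m)
  δ-level {x} zero    i eq i≤ | no i≢m = ⊥-elim (i≢m (n≤0⇒n≡0 i≤))
  δ-level {x} (suc m) i eq i≤ | no i≢m with δ-step eq
  ... | z , eq′ = δ-level m i eq′ (s≤s⁻¹ (≤∧≢⇒< i≤ i≢m))

  -- The levels 0, …, δ x y of δ · y are all inhabited, so δ x y + 1 vertices exist.
  δ<n : ∀ x y → δ x y < n
  δ<n x y = injective⇒≤ {f = f} inj
    where
    level : (i : Fin (suc (δ x y))) → ∃ λ z → δ z y ≡ toℕ i
    level i = δ-level (δ x y) (toℕ i) refl (s≤s⁻¹ (toℕ<n i))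
    f : Fin (suc (δ x y)) → Fin n
    f i = proj₁ (level i)
    inj : ∀ {i j} → f i ≡ f j → i ≡ j
    inj {i} {j} eq = toℕ-injective
      (trans (sym (proj₂ (level i))) (trans (cong (λ z → δ z y) eq) (proj₂ (level j))))

  ∂-walk : ∀ x y → Walk (∂ Γ x y) x y
  ∂-walk x y = mk (leastBelow-T (λ k → walk Γ k x y) n (δ x y) (δ<n x y) (Walk.holds (δ-walk x y)))

  ∂-≤ : ∀ {k x y} → Walk k x y → ∂ Γ x y ≤ k
  ∂-≤ {k} {x} {y} (mk t) = leastBelow-≤ (λ k → walk Γ k x y) n k t

  ∂-refl : ∀ x → ∂ Γ x x ≡ 0
  ∂-refl x = n≤0⇒n≡0 (∂-≤ (walk-refl x))

  ∂-zero : ∀ {x y} → ∂ Γ x y ≡ 0 → x ≡ y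
  ∂-zero {x} {y} eq = walk-0 (subst (λ k → Walk k x y) eq (∂-walk x y))

  ∂-triangle : ∀ x y z → ∂ Γ x z ≤ ∂ Γ x y + ∂ Γ y z
  ∂-triangle x y z = ∂-≤ (walk-++ (∂-walk x y) (∂-walk y z))

  ∂-adj : ∀ {x y} → T (Adj x y) → ∂ Γ x y ≡ 1
  ∂-adj {x} {y} a = ≤-antisym (∂-≤ (walk-∷ a (walk-refl y))) (n≢0⇒n>0 ≢0)
    where
    ≢0 : ∂ Γ x y ≢ 0
    ≢0 eq with ∂-zero eq
    ... | refl = subst T (loopless x) a

  ∂-step : ∀ {k x y} → ∂ Γ x y ≡ suc k → ∃ λ z → ∂ Γ x z ≡ 1 × ∂ Γ z y ≡ k
  ∂-step {k} {x} {y} eq with walk-∷⁻ (subst (λ m → Walk m x y) eq (∂-walk x y))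
  ... | z , a , t = z , ∂-adj a , ≤-antisym (∂-≤ t)
        (s≤s⁻¹ (subst (_≤ suc (∂ Γ z y)) eq (∂-≤ (walk-∷ a (∂-walk z y)))))

-- From intersection numbers to transport of configurations

module Regularity (Γ : Digraph) (wdr : WeaklyDistanceRegular Γ)
                  (comm : Commutative Γ) (qt : QuasiThin Γ) where
  open Digraph Γ
  open Distance Γ (proj₁ wdr)

  rel : Fin n → Fin n → ℕ × ℕ
  rel = ∂̃ Γ

  inD : ∀ x y → InD Γ (rel x y)
  inD x y = x , y , refl

  mid⁺ : ∀ {x y z i j} → rel x z ≡ i → rel z y ≡ j → T ((rel x z =ᵖ i) ∧ (rel z y =ᵖ j))
  mid⁺ {x} {y} {z} {i} p q = Equivalence.from (T-∧ {rel x z =ᵖ i}) (=ᵖ⁺ p , =ᵖ⁺ q)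

  mid⁻ : ∀ {x y z i j} → T ((rel x z =ᵖ i) ∧ (rel z y =ᵖ j)) → rel x z ≡ i × rel z y ≡ j
  mid⁻ {x} {y} {z} {i} t with Equivalence.to (T-∧ {rel x z =ᵖ i}) t
  ... | s , u = =ᵖ⁻ s , =ᵖ⁻ u

  transport : ∀ {x y x′ y′ z} → rel x y ≡ rel x′ y′ →
              ∃ λ z′ → rel x′ z′ ≡ rel x z × rel z′ y′ ≡ rel z y
  transport {x} {y} {x′} {y′} {z} eq
    with count≥1⁻ _ (subst (1 ≤_) (proj₂ wdr _ _ (inD x z) (inD z y) x y x′ y′ eq)
                       (count≥1 _ z (mid⁺ refl refl)))
  ... | z′ , t = z′ , mid⁻ t

  transport₂ : ∀ {x y x′ y′ z w} → rel x y ≡ rel x′ y′ →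
               z ≢ w → rel x w ≡ rel x z → rel w y ≡ rel z y →
               ∃ λ z′ → ∃ λ w′ → z′ ≢ w′ × (rel x′ z′ ≡ rel x z × rel z′ y′ ≡ rel z y)
                                          × (rel x′ w′ ≡ rel x z × rel w′ y′ ≡ rel z y)
  transport₂ {x} {y} {x′} {y′} {z} {w} eq z≢w p q
    with count≥2⁻ _ (subst (2 ≤_) (proj₂ wdr _ _ (inD x z) (inD z y) x y x′ y′ eq)
                       (count≥2 _ z w z≢w (mid⁺ refl refl) (mid⁺ p q)))
  ... | z′ , w′ , z′≢w′ , t , u = z′ , w′ , z′≢w′ , mid⁻ t , mid⁻ u

  commute : ∀ x y z → ∃ λ z′ → rel x z′ ≡ rel z y × rel z′ y ≡ rel x z
  commute x y z
    with count≥1⁻ _ (subst (1 ≤_) (comm _ _ (inD x z) (inD z y) x y)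
                       (count≥1 _ z (mid⁺ refl refl)))
  ... | z′ , t = z′ , mid⁻ t

  atMost2 : ∀ {x a b c} → rel x b ≡ rel x a → rel x c ≡ rel x a → a ≡ b ⊎ a ≡ c ⊎ b ≡ c
  atMost2 {x} {a} {b} {c} p q with a Fin.≟ b | a Fin.≟ c | b Fin.≟ c
  ... | yes e | _ | _ = inj₁ e
  ... | no _ | yes e | _ = inj₂ (inj₁ e)
  ... | no _ | no _ | yes e = inj₂ (inj₂ e)
  ... | no ab | no ac | no bc = contradiction
    (≤-trans (count≥3 _ a b c ab ac bc (mid⁺ refl refl) (mid⁺ p (flip p)) (mid⁺ q (flip q)))
             (proj₁ qt (rel x a) (rel a x) (inD x a) (inD a x) x x))
    λ { (s≤s (s≤s ())) }
    where
    flip : ∀ {u v} → rel x u ≡ rel x v → rel u x ≡ rel v x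
    flip e = cong (λ (i , j) → j , i) e

-- Of the intersection numbers only the facts “≥ 1” and “≥ 2” matter, and that valencies are ≤ 2.
record Scheme : Set where
  field
    n          : ℕ
    dist       : Fin n → Fin n → ℕ
    dist-refl  : ∀ x → dist x x ≡ 0
    dist-zero  : ∀ {x y} → dist x y ≡ 0 → x ≡ y
    triangle   : ∀ x y z → dist x z ≤ dist x y + dist y z
    dist-step  : ∀ {k x y} → dist x y ≡ suc k → ∃ λ z → dist x z ≡ 1 × dist z y ≡ k

  rel : Fin n → Fin n → ℕ × ℕ
  rel x y = dist x y , dist y x

  field
    transport  : ∀ {x y x′ y′ z} → rel x y ≡ rel x′ y′ →
                 ∃ λ z′ → rel x′ z′ ≡ rel x z × rel z′ y′ ≡ rel z y
    transport₂ : ∀ {x y x′ y′ z w} → rel x y ≡ rel x′ y′ →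
                 z ≢ w → rel x w ≡ rel x z → rel w y ≡ rel z y →
                 ∃ λ z′ → ∃ λ w′ → z′ ≢ w′ × (rel x′ z′ ≡ rel x z × rel z′ y′ ≡ rel z y)
                                            × (rel x′ w′ ≡ rel x z × rel w′ y′ ≡ rel z y)
    commute    : ∀ x y z → ∃ λ z′ → rel x z′ ≡ rel z y × rel z′ y ≡ rel x z
    atMost2    : ∀ {x a b c} → rel x b ≡ rel x a → rel x c ≡ rel x a → a ≡ b ⊎ a ≡ c ⊎ b ≡ c

toScheme : (Γ : Digraph) → WeaklyDistanceRegular Γ → Commutative Γ → QuasiThin Γ → Scheme
toScheme Γ wdr comm qt = record
  { n = Digraph.n Γ ; dist = ∂ Γ
  ; dist-refl = ∂-refl ; dist-zero = ∂-zero ; triangle = ∂-triangle ; dist-step = ∂-step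
  ; transport = transport ; transport₂ = transport₂ ; commute = commute ; atMost2 = atMost2 }
  where
  open Distance Γ (proj₁ wdr)
  open Regularity Γ wdr comm qt

-- Calculus of relations of valency at most 2, and walks by arc types

module Relations (S : Scheme) where
  open Scheme S public

  Vertex : Set
  Vertex = Fin n

  _ᵒ : ℕ × ℕ → ℕ × ℕ
  (i , j) ᵒ = j , i

  op : ∀ {x y R} → rel x y ≡ R → rel y x ≡ R ᵒ
  op refl = refl

  rel-refl : ∀ x → rel x x ≡ (0 , 0)
  rel-refl x = cong₂ _,_ (dist-refl x) (dist-refl x)

  fwd : ∀ {x y i j} → rel x y ≡ (i , j) → dist x y ≡ i
  fwd = cong proj₁

  bwd : ∀ {x y i j} → rel x y ≡ (i , j) → dist y x ≡ j
  bwd = cong proj₂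

  ≢-rel : ∀ {x y z P Q} → rel x y ≡ P → rel x z ≡ Q → P ≢ Q → y ≢ z
  ≢-rel p q P≢Q refl = P≢Q (trans (sym p) q)

  ≢-rel′ : ∀ {x y z P Q} → rel y x ≡ P → rel z x ≡ Q → P ≢ Q → y ≢ z
  ≢-rel′ p q P≢Q refl = P≢Q (trans (sym p) q)

  opaque
    mid : ∀ {x y x′ y′ z R P Q} → rel x y ≡ R → rel x′ y′ ≡ R → rel x z ≡ P → rel z y ≡ Q →
          ∃ λ z′ → rel x′ z′ ≡ P × rel z′ y′ ≡ Q
    mid r r′ p q with transport (trans r (sym r′))
    ... | z′ , p′ , q′ = z′ , trans p′ p , trans q′ q

  opaque
    right : ∀ {x y x′ y′ z R P Q} → rel x y ≡ R → rel x′ y′ ≡ R → rel x z ≡ P → rel y z ≡ Q →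
            ∃ λ z′ → rel x′ z′ ≡ P × rel y′ z′ ≡ Q
    right r r′ p q with mid r r′ p (op q)
    ... | z′ , p′ , q′ = z′ , p′ , op q′

  opaque
    left : ∀ {x y x′ y′ z R P Q} → rel x y ≡ R → rel x′ y′ ≡ R → rel z x ≡ P → rel z y ≡ Q →
           ∃ λ z′ → rel z′ x′ ≡ P × rel z′ y′ ≡ Q
    left r r′ p q with mid r r′ (op p) q
    ... | z′ , p′ , q′ = z′ , op p′ , q′

  opaque
    mid₂ : ∀ {x y x′ y′ z w R P Q} → rel x y ≡ R → rel x′ y′ ≡ R → z ≢ w →
           rel x z ≡ P → rel z y ≡ Q → rel x w ≡ P → rel w y ≡ Q →
           ∃ λ z′ → ∃ λ w′ → z′ ≢ w′ × (rel x′ z′ ≡ P × rel z′ y′ ≡ Q) × (rel x′ w′ ≡ P × rel w′ y′ ≡ Q)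
    mid₂ r r′ z≢w p q p₂ q₂
      with transport₂ (trans r (sym r′)) z≢w (trans p₂ (sym p)) (trans q₂ (sym q))
    ... | z′ , w′ , z′≢w′ , (a , b) , (c , d) =
      z′ , w′ , z′≢w′ , (trans a p , trans b q) , (trans c p , trans d q)

  opaque
    comm : ∀ {x y z P Q} → rel x z ≡ P → rel z y ≡ Q → ∃ λ z′ → rel x z′ ≡ Q × rel z′ y ≡ P
    comm {x} {y} {z} p q with commute x y z
    ... | z′ , a , b = z′ , trans a q , trans b p

  opaque
    two : ∀ {x a b c R} → rel x a ≡ R → rel x b ≡ R → rel x c ≡ R → a ≡ b ⊎ a ≡ c ⊎ b ≡ c
    two a b c = atMost2 (trans b (sym a)) (trans c (sym a))

  opaque
    third : ∀ {x a b c R} → a ≢ b → rel x a ≡ R → rel x b ≡ R → rel x c ≡ R → c ≡ a ⊎ c ≡ b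
    third a≢b p q r with two p q r
    ... | inj₁ e = ⊥-elim (a≢b e)
    ... | inj₂ (inj₁ e) = inj₁ (sym e)
    ... | inj₂ (inj₂ e) = inj₂ (sym e)

  opaque
    third′ : ∀ {x a b c R} → a ≢ b → rel a x ≡ R → rel b x ≡ R → rel c x ≡ R → c ≡ a ⊎ c ≡ b
    third′ a≢b p q r = third a≢b (op p) (op q) (op r)

  opaque
    three : ∀ {x a b c R} → a ≢ b → a ≢ c → b ≢ c → rel x a ≡ R → rel x b ≡ R → rel x c ≡ R → ⊥
    three ab ac bc p q r with two p q r
    ... | inj₁ e = ab e
    ... | inj₂ (inj₁ e) = ac e
    ... | inj₂ (inj₂ e) = bc e

  opaque
    distinct : ∀ {x y a b R} → a ≢ b → rel x a ≡ R → rel x b ≡ R →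
               ∃ λ c → ∃ λ d → c ≢ d × rel y c ≡ R × rel y d ≡ R
    distinct {x} {y} a≢b p q
      with mid₂ (rel-refl x) (rel-refl y) a≢b p (op p) q (op q)
    ... | c , d , c≢d , (p′ , _) , (q′ , _) = c , d , c≢d , p′ , q′

  opaque
    another : ∀ {x y a b c R} → a ≢ b → rel x a ≡ R → rel x b ≡ R →
              ∃ λ d → d ≢ c × rel y d ≡ R
    another {y = y} {c = c} a≢b p q with distinct {y = y} a≢b p q
    ... | u , v , u≢v , p′ , q′ with u Fin.≟ c
    ...   | no u≢c = u , u≢c , p′
    ...   | yes refl = v , u≢v ∘ sym , q′

  opaque
    commonOut : ∀ {x y z R} → rel z x ≡ R → rel z y ≡ R → ∃ λ u → rel x u ≡ R × rel y u ≡ R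
    commonOut p q with comm (op p) q
    ... | u , a , b = u , a , op b

  opaque
    commonIn : ∀ {x y z R} → rel x z ≡ R → rel y z ≡ R → ∃ λ u → rel u x ≡ R × rel u y ≡ R
    commonIn p q with comm p (op q)
    ... | u , a , b = u , op a , b

  opaque
    -- Transporting `y` from the pair `(z , x)` to `(z , y)` gives an `R`-successor `w` of `z` with
    -- `rel y w` equal to `rel x y`; if `x ≢ y`, valency 2 leaves only `x` for `w`.
    symOut : ∀ {x y z R} → rel z x ≡ R → rel z y ≡ R → rel x y ≡ rel y x
    symOut {x} {y} {z} p q with right p q q (refl {x = rel x y})
    ... | w , a , b with x Fin.≟ y
    ...   | yes refl = refl
    ...   | no x≢y with third x≢y p q a
    ...     | inj₁ refl = sym b
    ...     | inj₂ refl = ⊥-elim (x≢y (dist-zero (trans (sym (fwd b)) (dist-refl y))))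

  opaque
    symIn : ∀ {x y z R} → rel x z ≡ R → rel y z ≡ R → rel x y ≡ rel y x
    symIn p q = symOut (op p) (op q)

  opaque
    dist-symOut : ∀ {x y z R} → rel z x ≡ R → rel z y ≡ R → dist x y ≡ dist y x
    dist-symOut p q = cong proj₁ (symOut p q)

  opaque
    dist-symIn : ∀ {x y z R} → rel x z ≡ R → rel y z ≡ R → dist x y ≡ dist y x
    dist-symIn p q = cong proj₁ (symIn p q)

  opaque
    -- Regularity carries `a` and `b` along together, and their two images exhaust the
    -- `B`-successors of `v`.
    allSucc : ∀ {x y a b u v w A B R} → rel x y ≡ A → a ≢ b → rel y a ≡ B → rel y b ≡ B →
              rel x a ≡ R → rel x b ≡ R → rel u v ≡ A → rel v w ≡ B → rel u w ≡ R
    allSucc e a≢b ya yb xa xb e′ vw with mid₂ e e′ a≢b xa (op ya) xb (op yb)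
    ... | a′ , b′ , a′≢b′ , (ua , av) , (ub , bv) with third a′≢b′ (op av) (op bv) vw
    ...   | inj₁ refl = ua
    ...   | inj₂ refl = ub

  Thin : ℕ × ℕ → Set
  Thin R = ∀ {x y z} → rel x y ≡ R → rel x z ≡ R → y ≡ z

  thinᵒ : ∀ {R} → Thin R → ∀ {x y z} → rel x z ≡ R → rel y z ≡ R → x ≡ y
  thinᵒ t p q with commonIn p q
  ... | u , a , b = t a b

  thin-at : ∀ {a e R} → (∀ {w} → rel a w ≡ R → w ≡ e) → Thin R
  thin-at h {y = y} {z} p q with y Fin.≟ z
  ... | yes e = e
  ... | no y≢z with distinct y≢z p q
  ...   | c , d , c≢d , p′ , q′ = ⊥-elim (c≢d (trans (h p′) (sym (h q′))))

  _∈²_ : ℕ × ℕ → ℕ × ℕ → Set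
  R ∈² E = ∃ λ x → ∃ λ y → ∃ λ z → rel x y ≡ E × rel y z ≡ E × rel x z ≡ R

  next² : ∀ {R E x y} → R ∈² E → rel x y ≡ E → ∃ λ z → rel y z ≡ E × rel x z ≡ R
  next² (_ , _ , _ , p , q , r) e with right p e r q
  ... | z , a , b = z , b , a

  prev² : ∀ {R E y z} → R ∈² E → rel y z ≡ E → ∃ λ x → rel x y ≡ E × rel x z ≡ R
  prev² (_ , _ , _ , p , q , r) e = left q e p r

  mid² : ∀ {R E x z} → R ∈² E → rel x z ≡ R → ∃ λ y → rel x y ≡ E × rel y z ≡ E
  mid² (_ , _ , _ , p , q , r) e = mid r e p q

  -- Each of the two relations claims one of the at most two `E`-successors of `y`.
  square-dichotomy : ∀ {E R₁ R₂ x y z} → R₁ ≢ R₂ → R₁ ∈² E → R₂ ∈² E →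
                     rel x y ≡ E → rel y z ≡ E → rel x z ≡ R₁ ⊎ rel x z ≡ R₂
  square-dichotomy R₁≢R₂ s₁ s₂ p q with next² s₁ p | next² s₂ p
  ... | z₁ , e₁ , r₁ | z₂ , e₂ , r₂ with third (≢-rel r₁ r₂ R₁≢R₂) e₁ e₂ q
  ...   | inj₁ refl = inj₁ r₁
  ...   | inj₂ refl = inj₂ r₂

  -- The two out-neighbours b, b′ of a vertex a have a common out-neighbour.
  square-thin : ∀ {E R₁ R₂} → R₁ ≢ R₂ → R₁ ∈² E → R₂ ∈² E → Thin R₁ ⊎ Thin R₂
  square-thin {E} {R₁} {R₂} R₁≢R₂ s₁@(a , b , e , ab , be , ae) s₂
    with next² s₂ ab
  ... | e₂ , be₂ , ae₂ with another {c = b} (≢-rel ae ae₂ R₁≢R₂) be be₂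
  ...   | b′ , b′≢b , ab′ with commonOut ab ab′
  ...     | u , bu , b′u = case
    where
    -- The vertex `u` follows both `b` and `b′` and so uses up one successor of each; the other one
    -- is in relation `Q` to `a`. Hence `u` is the only `P`-neighbour of `a`.
    single : ∀ {P Q} → P ≢ Q → P ∈² E → Q ∈² E → rel a u ≡ P → Thin P
    single {P} {Q} P≢Q s t au = thin-at go
      where
      only : ∀ {v w} → rel a v ≡ E → rel v u ≡ E → rel v w ≡ E → rel a w ≡ P → w ≡ u
      only av vu vw aw with next² t av
      ... | q , vq , aq with third (≢-rel au aq P≢Q) vu vq vw
      ...   | inj₁ w≡u = w≡u
      ...   | inj₂ refl = ⊥-elim (P≢Q (trans (sym aw) aq))
      go : ∀ {w} → rel a w ≡ P → w ≡ u
      go aw with mid² s aw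
      ... | v , av , vw with third b′≢b ab′ ab av
      ...   | inj₁ refl = only av b′u vw aw
      ...   | inj₂ refl = only av bu vw aw
    case : Thin R₁ ⊎ Thin R₂
    case with third (≢-rel ae ae₂ R₁≢R₂) be be₂ bu
    ... | inj₁ refl = inj₁ (single R₁≢R₂ s₁ s₂ ae)
    ... | inj₂ refl = inj₂ (single (R₁≢R₂ ∘ sym) s₂ s₁ ae₂)

  Arc : ℕ → Vertex → Vertex → Set
  Arc r x y = rel x y ≡ (1 , r)

  arc : ∀ {x y} → dist x y ≡ 1 → Arc (dist y x) x y
  arc p = cong₂ _,_ p refl

  arc≢ : ∀ {r s} → r ≢ s → _≢_ {A = ℕ × ℕ} (1 , r) (1 , s)
  arc≢ r≢s e = r≢s (cong proj₂ e)

  arc-inj : ∀ {r s x y} → Arc r x y → Arc s x y → r ≡ s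
  arc-inj p q = cong proj₂ (trans (sym p) q)

  dist-arc : ∀ {r x y} z → Arc r x y → dist x z ≤ suc (dist y z)
  dist-arc {x = x} {y} z a = subst (λ k → dist x z ≤ k + dist y z) (fwd a) (triangle x y z)

  dist-arc′ : ∀ {r x y} z → Arc r x y → dist z y ≤ suc (dist z x)
  dist-arc′ {x = x} {y} z a =
    subst (dist z y ≤_) (trans (cong (dist z x +_) (fwd a)) (+-comm (dist z x) 1)) (triangle z x y)

  -- Walks along arcs of types (1 , r), with r running through the list.
  W : List ℕ → Vertex → Vertex → Set
  W []      x y = x ≡ y
  W (r ∷ l) x y = ∃ λ z → Arc r x z × W l z y

  W-transport : ∀ l {x y x′ y′ R} → rel x y ≡ R → rel x′ y′ ≡ R → W l x y → W l x′ y′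
  W-transport []      {x} p p′ refl =
    dist-zero (trans (fwd p′) (trans (sym (fwd p)) (dist-refl x)))
  W-transport (r ∷ l) p p′ (z , a , w) with mid p p′ a refl
  ... | z′ , a′ , q = z′ , a′ , W-transport l refl q w

  W-perm : ∀ {l l′ x y} → l ↭ l′ → W l x y → W l′ x y
  W-perm ↭.refl w = w
  W-perm (prep r p) (z , a , w) = z , a , W-perm p w
  W-perm (swap r s p) (z , a , v , b , w) with comm a b
  ... | z′ , b′ , a′ = z′ , b′ , v , a′ , W-perm p w
  W-perm (↭.trans p q) w = W-perm q (W-perm p w)

  W-++ : ∀ l {l′ x y z} → W l x y → W l′ y z → W (l ++ l′) x z
  W-++ []      refl w′ = w′
  W-++ (r ∷ l) (z , a , w) w′ = z , a , W-++ l w w′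

  W-length : ∀ l {x y} → W l x y → dist x y ≤ length l
  W-length []      {x} refl = ≤-reflexive (dist-refl x)
  W-length (r ∷ l) {y = y} (z , a , w) = ≤-trans (dist-arc y a) (s≤s (W-length l w))

  geodesic : ∀ k {x y} → dist x y ≡ k → ∃ λ l → length l ≡ k × W l x y
  geodesic zero    eq = [] , refl , dist-zero eq
  geodesic (suc k) eq with dist-step eq
  ... | z , a , eq′ with geodesic k eq′
  ...   | l , len , w = _ ∷ l , cong suc len , z , arc a , w

  Cl : List ℕ → Set
  Cl l = ∃ λ x → W l x x

  Cl-at : ∀ l → Cl l → ∀ y → W l y y
  Cl-at l (x , w) y = W-transport l (rel-refl x) (rel-refl y) w

  Cl-perm : ∀ {l l′} → l ↭ l′ → Cl l → Cl l′
  Cl-perm p (x , w) = x , W-perm p w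

  Cl-++ : ∀ l {l′ x y} → W l x y → W l′ y x → Cl (l ++ l′)
  Cl-++ l w w′ = _ , W-++ l w w′

  Cl-length : ∀ {r l} → Cl (r ∷ l) → r ≤ length l
  Cl-length {l = l} (x , z , a , w) = subst (_≤ length l) (bwd a) (W-length l w)

  bring : ∀ {a : ℕ} {l} → a ∈ l → ∃ λ l′ → l ↭ a ∷ l′
  bring (here refl) = _ , ↭.refl
  bring {l = b ∷ l} (there i) with bring i
  ... | l′ , p = b ∷ l′ , ↭.trans (prep b p) (swap b _ ↭.refl)

  Cl-length∈ : ∀ {r l} → r ∈ l → Cl l → r < length l
  Cl-length∈ r∈l c with bring r∈l
  ... | l′ , p = subst (_ <_) (sym (↭-length p)) (s≤s (Cl-length (Cl-perm p c)))

-- Circuits with at least two arcs of the extremal type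

All≡⇒replicate : ∀ {r : ℕ} {M} → All (_≡ r) M → M ≡ replicate (length M) r
All≡⇒replicate [] = refl
All≡⇒replicate (refl ∷ a) = cong (_ ∷_) (All≡⇒replicate a)

module Circuits (S : Scheme) where
  open Relations S public

  back≥ : ∀ {r x y z} → Arc r x y → dist y z ≡ 1 → r ≤ suc (dist z x)
  back≥ {x = x} a b = subst (_≤ _) (bwd a) (dist-arc x (arc b))

  back≥′ : ∀ {r x y z} → dist x y ≡ 1 → Arc r y z → r ≤ suc (dist z x)
  back≥′ {z = z} a b = subst (_≤ _) (bwd b) (dist-arc′ z (arc a))

  back-exact : ∀ {r e l x y z} → suc (length l) ≡ r → Arc r x y → Arc e y z → W l z x →
               dist z x ≡ length l
  back-exact {l = l} len a b w =
    ≤-antisym (W-length l w) (s≤s⁻¹ (subst (_≤ _) (sym len) (back≥ a (fwd b))))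

  dist≤2 : ∀ {e f x y z} → Arc e x y → Arc f y z → dist x z ≤ 2
  dist≤2 {z = z} a b = ≤-trans (dist-arc z a) (s≤s (≤-reflexive (fwd b)))

  -- A shorter way from `x` to `z` would close with `l` to a walk of at most `r` arcs that still
  -- contains an arc of type `r`, namely the one in `l`.
  fwd-exact : ∀ {r e f l x y z} → suc (length l) ≡ r → r ∈ l → Arc e x y → Arc f y z → W l z x →
              dist x z ≡ 2
  fwd-exact {r} {l = l} {x} {z = z} len r∈l a b w with geodesic (dist x z) refl
  ... | l′ , len′ , w′ = ≤-antisym (dist≤2 a b) (+-cancelʳ-≤ (length l) 2 (dist x z) (begin
      2 + length l             ≡⟨ cong suc len ⟩
      suc r                    ≤⟨ Cl-length∈ (∈-++⁺ʳ l′ r∈l) (Cl-++ l′ w′ w) ⟩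
      length (l′ ++ l)         ≡⟨ length-++ l′ ⟩
      length l′ + length l     ≡⟨ cong (_+ length l) len′ ⟩
      dist x z + length l      ∎))
    where open ≤-Reasoning

  exact : ∀ {r e l x y z} → suc (length l) ≡ r → r ∈ l → Arc r x y → Arc e y z → W l z x →
          rel x z ≡ (2 , length l)
  exact len r∈l a b w = cong₂ _,_ (fwd-exact len r∈l a b w) (back-exact len a b w)

  Sq : ℕ → ℕ → Set
  Sq r s = (1 , s) ∈² (1 , r)

  -- M lists the types of the remaining arcs of a closed walk of r + 1 arcs through an arc of type r.
  data Circuit : ℕ → List ℕ → Set where
    pure  : ∀ {r M} → All (_≡ r) M → Circuit r M
    mixed : ∀ {k M} → M ↭ 2 + k ∷ replicate (1 + k) (1 + k) → Sq (2 + k) (1 + k) → Circuit (2 + k) M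

  Good : ℕ → Set
  Good r = ∀ M → length M ≡ r → Cl (r ∷ M) → Circuit r M

  -- The counterpart of `Pure` for closed walks, whose vertices may repeat.
  Pureᶜ : ℕ → Set
  Pureᶜ r = ∀ N → length N ≡ r → Cl (r ∷ N) → All (_≡ r) N

  Sq-irrefl : ∀ {r} → 2 ≤ r → ¬ Sq r r
  Sq-irrefl {r} 2≤r (x , y , z , xy , yz , xz) with mid² (x , y , z , xy , yz , xz) xy
  ... | w , xw , wy with two xy xz xw
  ... | inj₁ refl = 0≢1+n (trans (sym (dist-refl y)) (fwd yz))
  ... | inj₂ (inj₁ refl) = 0≢1+n (trans (sym (dist-refl y)) (fwd wy))
  ... | inj₂ (inj₂ refl) = <⇒≢ 2≤r (trans (sym (fwd wy)) (bwd yz))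

  -- Composites `r` `r` and `r` `E` have the same forced relation `(2 , 2 + m)`, so there is also a
  -- walk with four arcs of type `r`. Exchanging back inside it yields two middle vertices, whence
  -- any two consecutive arcs of type `r` span this relation; its valency 2 then makes the arc of
  -- type `E` one of type `r`.
  no-three : ∀ {m M E} → length M ≡ m → E ≢ 3 + m → ¬ Cl (3 + m ∷ 3 + m ∷ 3 + m ∷ E ∷ M)
  no-three {m} {M} {E} refl E≢r c@(a , b , ab , e , be , wₑ)
    with Cl-perm {l′ = 3 + m ∷ E ∷ 3 + m ∷ 3 + m ∷ M} (prep _ (↭.trans (prep _ (swap _ E ↭.refl)) (swap _ E ↭.refl))) c
  ... | x , y , xy , z , yz , w =
    let r = 3 + m
        ae = exact {r} refl (here refl) ab be wₑ
        xz = exact {r} refl (here refl) xy yz w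
        y′ , xy′ , y′z = mid ae xz ab be
    in go xz xy yz (x , y′ , xy′ , z , y′z , w)
    where
    r = 3 + m
    go : ∀ {x y z} → rel x z ≡ (2 , 2 + m) → Arc r x y → Arc E y z → Cl (r ∷ r ∷ r ∷ r ∷ M) → ⊥
    go xz xy yz (p , x₀ , px₀ , x₁ , x₀x₁ , x₂ , x₁x₂ , w)
      with mid xz (exact refl (here refl) x₀x₁ x₁x₂ (W-perm (++-comm (r ∷ M) (r ∷ [])) (W-++ (r ∷ M) w (x₀ , px₀ , refl)))) xy yz
    ... | y , x₀y , yx₂ = E≢r (arc-inj yx₂ (last (distinct {y = y} x₁≢y x₀x₁ x₀y)))
      where
      x₁≢y : x₁ ≢ y
      x₁≢y = ≢-rel′ x₁x₂ yx₂ (arc≢ (E≢r ∘ sym))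
      succ : ∀ {u v w} → Arc r u v → Arc r v w → rel u w ≡ (2 , 2 + m)
      succ = allSucc px₀ x₁≢y x₀x₁ x₀y (exact {r} refl (here refl) px₀ x₀x₁ (x₂ , x₁x₂ , w))
                                      (exact {r} refl (there (here refl)) px₀ x₀y (x₂ , yx₂ , w))
      last : (∃ λ s → ∃ λ t → s ≢ t × Arc r y s × Arc r y t) → Arc r y x₂
      last (s , t , s≢t , ys , yt) =
        [ (λ e → subst (Arc r y) (sym e) ys) , (λ e → subst (Arc r y) (sym e) yt) ]′
          (third s≢t (succ x₀y ys) (succ x₀y yt) (succ x₀x₁ x₁x₂))

  -- At distance 2, `(x , z)` would have the relation of a composite `r` `E`; exchanging that
  -- composite for two arcs of type `r` gives three of them beside `F`, against `no-three`.
  square-arc : ∀ {m M E x y z} → length M ≡ 1 + m → All (_≢ 3 + m) (E ∷ M) →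
               Arc (3 + m) x y → Arc (3 + m) y z → W (E ∷ M) z x → Arc (2 + m) x z
  square-arc {m} {F ∷ M} {E} {x} {y} {z} len (E≢r ∷ F≢r ∷ _) xy yz w = by-dist (dist x z) refl
    where
    r = 3 + m
    zx : dist z x ≡ 2 + m
    zx = trans (back-exact {r} (cong (2 +_) len) xy yz w) (cong suc len)
    by-dist : ∀ k → dist x z ≡ k → Arc (2 + m) x z
    by-dist 0 eq = ⊥-elim (0≢1+n (trans (sym (dist-refl x)) (subst (λ v → dist v x ≡ 2 + m) (sym (dist-zero eq)) zx)))
    by-dist 1 eq = cong₂ _,_ eq zx
    by-dist (suc (suc (suc k))) eq = contradiction (≤-trans (≤-reflexive (sym eq)) (dist≤2 xy yz)) (λ { (s≤s (s≤s ())) })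
    by-dist 2 eq with Cl-perm {l′ = r ∷ E ∷ r ∷ F ∷ M} (prep r (swap r E ↭.refl)) (x , y , xy , z , yz , w)
    ... | x′ , y′ , xy′ , z′ , yz′ , w′
      with mid (cong₂ _,_ eq (trans zx (sym (cong suc len)))) (exact {r} (cong (2 +_) len) (here refl) xy′ yz′ w′) xy yz
    ...   | y″ , xy″ , yz″ = ⊥-elim (no-three (suc-injective len) F≢r (x′ , y″ , xy″ , z′ , yz″ , w′))

  -- The two arcs are replaced by their chord of type `2 + m`, to which `Good` applies. In its mixed
  -- case, exchanging the composites `r` `2 + m` and `r` `1 + m` would close such a chord with arcs
  -- of type `1 + m` only, which fits neither form of `Circuit`.
  two-of-type : ∀ {m M} → Good (2 + m) → length M ≡ 2 + m → All (_≢ 3 + m) M → Cl (3 + m ∷ 3 + m ∷ M) →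
                Sq (3 + m) (2 + m) × All (_≡ 2 + m) M
  two-of-type {m} {E ∷ M} good len M≢ (x , y , xy , z , yz , w) = (x , y , z , xy , yz , xz) , all
    where
    r = 3 + m
    xz : Arc (2 + m) x z
    xz = square-arc (suc-injective len) M≢ xy yz w
    all : All (_≡ 2 + m) (E ∷ M)
    all with good _ len (x , z , xz , w)
    ... | pure a = a
    ... | mixed p _ = ⊥-elim (go (Cl-perm {l = r ∷ r ∷ E ∷ M} {l′ = r ∷ 2 + m ∷ r ∷ 1 + m ∷ replicate m (1 + m)}
                                      (prep r (↭.trans (prep r p) (swap r _ ↭.refl))) (x , y , xy , z , yz , w))
                                 (Cl-perm {l = r ∷ r ∷ E ∷ M} {l′ = r ∷ 1 + m ∷ r ∷ 2 + m ∷ replicate m (1 + m)}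
                                      (prep r (↭.trans (prep r (↭.trans p (swap _ _ ↭.refl))) (swap r _ ↭.refl))) (x , y , xy , z , yz , w)))
      where
      len-rep : ∀ {s} → suc (length (r ∷ s ∷ replicate m (1 + m))) ≡ r
      len-rep = cong (3 +_) (length-replicate m)
      rep≢ : ∀ {s} k → 1 + m ≢ s → All (_≢ s) (replicate k (1 + m))
      rep≢ k e = replicate⁺ k e
      go : Cl (r ∷ 2 + m ∷ r ∷ 1 + m ∷ replicate m (1 + m)) → Cl (r ∷ 1 + m ∷ r ∷ 2 + m ∷ replicate m (1 + m)) → ⊥
      go (a , b , ab , e , be , v) (a′ , b′ , ab′ , e′ , be′ , v′)
        with mid (exact (len-rep {2 + m}) (here refl) ab′ be′ v′) (exact (len-rep {1 + m}) (here refl) ab be v) ab′ be′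
      ... | b″ , ab″ , be″ with Cl-perm {l′ = r ∷ r ∷ replicate (2 + m) (1 + m)} (prep r (swap _ r ↭.refl)) (a , b″ , ab″ , e , be″ , v)
      ...   | x , y , xy , z , yz , w
        with good (replicate (2 + m) (1 + m)) (length-replicate (2 + m))
               (x , z , square-arc (length-replicate (1 + m)) (rep≢ (2 + m) (λ ())) xy yz w , w)
      ...     | pure (() ∷ _)
      ...     | mixed q _ with All-resp-↭ q (rep≢ {2 + m} (2 + m) (λ ()))
      ...       | ≢ ∷ _ = ≢ refl

  -- One arc of a mixed circuit of type `2 + m` may be replaced by two arcs of type `3 + m`;
  -- `two-of-type` then makes the remaining types equal.
  square-pure : ∀ {m} → Good (2 + m) → Sq (3 + m) (2 + m) → Pureᶜ (2 + m)
  square-pure {m} good sq N len (x , y , xy , w) with good N len (x , y , xy , w)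
  ... | pure a = a
  ... | mixed p _ with mid² sq xy
  ...   | v , xv , vy = proj₂ (two-of-type good len
            (All-resp-↭ (↭-sym p) ((λ ()) ∷ replicate⁺ (1 + m) (λ ()))) (x , v , xv , y , vy , w))

  pure-one : Pureᶜ 1
  pure-one (n ∷ []) len (x , y , xy , z , yz , refl) = cong proj₂ (trans (sym yz) (op xy)) ∷ []

  good-one : Good 1
  good-one M len c = pure (pure-one M len c)

-- Translations by thin relations and the lattice over a circuit

module Translations (S : Scheme) where
  open Circuits S public

  Sq-one : ∀ {s} → Sq 1 s → s ≡ 1
  Sq-one (x , y , z , xy , yz , xz) =
    trans (sym (bwd xz)) (trans (dist-symIn (op yz) xy) (fwd xz))

  circuit-types : ∀ {r M} → Circuit r M → All (λ t → t ≡ r ⊎ suc t ≡ r) M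
  circuit-types (pure a) = All.map inj₁ a
  circuit-types (mixed {k} p _) =
    All-resp-↭ (↭-sym p) (inj₁ refl ∷ replicate⁺ (1 + k) (inj₂ refl))

  W-replicate : ∀ {r x y z} i j → W (replicate i r) x y → W (replicate j r) y z →
                W (replicate (i + j) r) x z
  W-replicate zero    j refl w′ = w′
  W-replicate (suc i) j (z , a , w) w′ = z , a , W-replicate i j w w′

  pure-cycle : ∀ {r x y} → Pureᶜ r → Arc r x y → W (replicate r r) y x
  pure-cycle {r} {x} {y} p a with geodesic r (bwd a)
  ... | l , refl , w = subst (λ l → W l y x) (All≡⇒replicate (p l refl (x , y , a , w))) w

  module Translation {R : ℕ × ℕ} (thin : Thin R) {a b : Vertex} (ab : rel a b ≡ R) where

    private
      image : ∀ x → ∃ λ y → rel x y ≡ R × rel y x ≡ R ᵒ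
      image x = mid (rel-refl a) (rel-refl x) ab (op ab)

    κ : Vertex → Vertex
    κ x = proj₁ (image x)

    κ-rel : ∀ x → rel x (κ x) ≡ R
    κ-rel x = proj₁ (proj₂ (image x))

    κ-unique : ∀ {x y} → rel x y ≡ R → y ≡ κ x
    κ-unique p = thin p (κ-rel _)

    κ-injective : ∀ {x y} → κ x ≡ κ y → x ≡ y
    κ-injective {x} {y} e = thinᵒ thin (κ-rel x) (subst (λ v → rel y v ≡ R) (sym e) (κ-rel y))

    κ-resp : ∀ {x y x′ y′} → rel x y ≡ rel x′ y′ → rel x (κ y) ≡ rel x′ (κ y′)
    κ-resp {y = y} {y′ = y′} e with right refl (sym e) refl (κ-rel y)
    ... | z , p , q with thin q (κ-rel y′)
    ...   | refl = sym p

    -- Commutativity lets `R` precede `rel x y` instead of following it; thinness identifies the new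
    -- middle vertex with `κ x`.
    κ-auto : ∀ x y → rel (κ x) (κ y) ≡ rel x y
    κ-auto x y with comm {x} {κ y} {y} refl (κ-rel y)
    ... | z , p , q with thin p (κ-rel x)
    ...   | refl = q

    κ^ : ℕ → Vertex → Vertex
    κ^ zero    x = x
    κ^ (suc k) x = κ^ k (κ x)

    κ^-+ : ∀ i j x → κ^ (i + j) x ≡ κ^ j (κ^ i x)
    κ^-+ zero    j x = refl
    κ^-+ (suc i) j x = κ^-+ i j (κ x)

    κ^-auto : ∀ k x y → rel (κ^ k x) (κ^ k y) ≡ rel x y
    κ^-auto zero    x y = refl
    κ^-auto (suc k) x y = trans (κ^-auto k (κ x) (κ y)) (κ-auto x y)

    κ^-resp : ∀ k {x y x′ y′} → rel x y ≡ rel x′ y′ → rel x (κ^ k y) ≡ rel x′ (κ^ k y′)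
    κ^-resp zero    e = e
    κ^-resp (suc k) e = κ^-resp k (κ-resp e)

    W-κ : ∀ {r} → R ≡ (1 , r) → ∀ k x → W (replicate k r) x (κ^ k x)
    W-κ e zero    x = refl
    W-κ e (suc k) x = κ x , trans (κ-rel x) e , W-κ e k (κ x)

    W-κ⁻ : ∀ {r} → R ≡ (1 , r) → ∀ k {x y} → W (replicate k r) x y → y ≡ κ^ k x
    W-κ⁻ e zero    refl = refl
    W-κ⁻ e (suc k) (z , a , w) = trans (W-κ⁻ e k w) (cong (κ^ k) (κ-unique (trans a (sym e))))

    turn : ∀ {E} → R ∈² E → ∀ {u v} → rel u v ≡ E → rel v (κ u) ≡ E
    turn {E} s {u} {v} e with next² s e
    ... | z , p , q = subst (λ w → rel v w ≡ E) (κ-unique q) p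

    κ-arc : ∀ {E u v} → rel u v ≡ E → rel (κ u) (κ v) ≡ E
    κ-arc e = trans (κ-auto _ _) e

  pure-square : ∀ {j x y z} → Arc (2 + j) x y → Arc (2 + j) y z →
                W (replicate (1 + j) (2 + j)) z x → rel x z ≡ (2 , 1 + j)
  pure-square {j} a b w =
    trans (exact (cong (2 +_) (length-replicate j)) (here refl) a b w)
          (cong (λ k → 2 , suc k) (length-replicate j))

  -- Thinness makes every successor `v` of `x₀` lead to `x₂`. Then `v` lies on a closed walk of the
  -- same kind and shares with `x₁` the thin relation to `x₃`.
  pure-square-thin : ∀ {j} → Cl (replicate (3 + j) (2 + j)) → Thin (2 , 1 + j) → Thin (1 , 2 + j)
  pure-square-thin {j} (x₀ , x₁ , a₀ , x₂ , a₁ , x₃ , a₂ , w) t = thin-at only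
    where
    only : ∀ {v} → Arc (2 + j) x₀ v → v ≡ x₁
    only {v} a =
      let g = pure-square a₀ a₁ (x₃ , a₂ , w)
          z , x₀z , vz = right a₀ a g a₁
          vx₂ = subst (Arc (2 + j) v) (t x₀z g) vz
          last : ∀ {u} → Arc (2 + j) x₀ u → Arc (2 + j) u x₂ → rel u x₃ ≡ (2 , 1 + j)
          last {u} x₀u ux₂ = pure-square ux₂ a₂
            (subst (λ k → W (replicate k (2 + j)) x₃ u) (+-comm j 1) (W-replicate j 1 w (u , x₀u , refl)))
      in thinᵒ t (last a vx₂) (last a₀ a₁)

  -- E-walks in the presence of a thin relation R ≠ g in E², where g is the relation of
  -- consecutive arcs on a circuit of arcs E: each arc has one straight continuation (relation g)
  -- and one turn (relation R).
  module Lattice {j : ℕ} (cl : Cl (replicate (3 + j) (2 + j)))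
                 {R : ℕ × ℕ} (thin : Thin R) (R∈ : R ∈² (1 , 2 + j)) (R≢g : R ≢ (2 , 1 + j)) where

    private
      m N : ℕ
      m = 2 + j
      N = 3 + j
      g : ℕ × ℕ
      g = 2 , 1 + j

    open Translation thin (proj₂ (proj₂ (proj₂ (proj₂ (proj₂ R∈))))) public

    g∈ : g ∈² (1 , m)
    g∈ = let (x , y , xy , z , yz , w) = cl in x , y , z , xy , yz , pure-square xy yz w

    record Line (s : ℕ → Vertex) : Set where
      field
        step     : ∀ i → Arc m (s i) (s (suc i))
        straight : ∀ i → rel (s i) (s (2 + i)) ≡ g
    open Line

    straight-unique : ∀ {x y z z′} → Arc m x y → Arc m y z → rel x z ≡ g →
                      Arc m y z′ → rel x z′ ≡ g → z′ ≡ z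
    straight-unique xy yz xz yz′ xz′ with next² R∈ xy
    ... | u , yu , xu with third (≢-rel xu xz R≢g) yu yz yz′
    ...   | inj₂ e = e
    ...   | inj₁ refl = ⊥-elim (R≢g (trans (sym xu) xz′))

    W-line : ∀ {s} → Line s → ∀ i → W (replicate i m) (s 0) (s i)
    W-line l zero    = refl
    W-line {s} l (suc i) = subst (λ k → W (replicate k m) (s 0) (s (suc i))) (+-comm i 1)
                         (W-replicate i 1 (W-line l i) (_ , step l i , refl))

    -- The closed walk through the first arc of the line spans `g` over any two consecutive arcs, so
    -- by `straight-unique` it runs along the line.
    follow : ∀ {s} → Line s → ∀ i k → suc i + k ≡ N → W (replicate k m) (s (suc i)) (s 0)
    follow {s} l zero .(2 + j) refl =
      let (x , y , xy , w) = cl in W-transport (replicate (2 + j) m) (op xy) (op (step l 0)) w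
    follow {s} l (suc i) k e with follow l i (suc k) (trans (cong suc (+-suc i k)) e)
    ... | u , a , w = subst (λ v → W (replicate k m) v (s 0))
          (straight-unique (step l i) (step l (suc i)) (straight l i) a
            (pure-square (step l i) a
              (subst (λ k → W (replicate k m) u (s i))
                     (trans (+-comm k i) (suc-injective (suc-injective e)))
                     (W-replicate k i w (W-line l i))))) w

    line-closes : ∀ {s} → Line s → s N ≡ s 0
    line-closes l = follow l (2 + j) 0 (+-identityʳ N)

    shift-line : ∀ {s} a → Line s → Line (λ i → s (i + a))
    shift-line a l = record { step = λ i → step l (i + a) ; straight = λ i → straight l (i + a) }

    periodic : ∀ {s} → Line s → ∀ a → s (N + a) ≡ s a
    periodic l a = line-closes (shift-line a l)

    private
      ray : (u v : Vertex) → Arc m u v → ℕ → Vertex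
      ray u v a zero    = u
      ray u v a (suc i) = ray v (proj₁ (next² g∈ a)) (proj₁ (proj₂ (next² g∈ a))) i

      ray-line : ∀ u v a → Line (ray u v a)
      ray-line u v a = record { step = steps u v a ; straight = straights u v a }
        where
        steps : ∀ u v a i → Arc m (ray u v a i) (ray u v a (suc i))
        steps u v a zero    = a
        steps u v a (suc i) = steps v _ _ i
        straights : ∀ u v a i → rel (ray u v a i) (ray u v a (2 + i)) ≡ g
        straights u v a zero    = proj₂ (proj₂ (next² g∈ a))
        straights u v a (suc i) = straights v _ _ i

    line-from : ∀ u → ∃ λ s → Line s × s 0 ≡ u
    line-from u with Cl-at (replicate N m) cl u
    ... | v , a , _ = ray u v a , ray-line u v a , refl

    -- Lines have period `N`, so `2 + j` steps forward amount to one step back and each step of the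
    -- new sequence is a turn. If two of them spanned `R`, cancelling `κ` would make two steps of
    -- `s` span `R`.
    transversal : ∀ {s} → Line s → Line (λ k → κ^ k (s (k * (2 + j))))
    transversal {s} l = record
      { step = λ k → trans (κ^-auto k (s (k * M)) (κ (s (M + k * M)))) (side (k * M))
      ; straight = λ k → trans (κ^-auto k (s (k * M)) (κ (κ (s (M + (M + k * M)))))) (side₂ (k * M)) }
      where
      M = 2 + j
      side : ∀ i → Arc m (s i) (κ (s (M + i)))
      side i = turn R∈ (subst (Arc m (s (M + i))) (periodic l i) (step l (M + i)))
      period₂ : ∀ i → s (2 + (M + (M + i))) ≡ s i
      period₂ i = trans (cong s (sym (+-suc N (M + i)))) (trans (periodic l (suc (M + i))) (periodic l i))
      no-turn : ∀ i → rel (s i) (κ (κ (s (M + (M + i))))) ≢ R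
      no-turn i p = R≢g (trans (sym (κ-rel _)) (trans
        (cong (rel (s (M + (M + i)))) (trans (κ-injective (κ-unique p)) (sym (period₂ i))))
        (straight l (M + (M + i)))))
      side₂ : ∀ i → rel (s i) (κ (κ (s (M + (M + i))))) ≡ g
      side₂ i = [ (λ p → ⊥-elim (no-turn i p)) , (λ p → p) ]′
                (square-dichotomy R≢g R∈ g∈ (side i) (κ-arc (side (M + i))))

    -- The transversal closes after `N` steps, at an index of `s` that is a multiple of the period;
    -- what closes is therefore `κ^ N` alone.
    κ^N : ∀ x → κ^ N x ≡ x
    κ^N x with line-from x
    ... | s , l , refl = trans (cong (κ^ N) (trans (sym (multiple (2 + j))) (cong s (*-comm (2 + j) N))))
                               (line-closes (transversal l))
      where
      multiple : ∀ k → s (k * N) ≡ s 0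
      multiple zero    = refl
      multiple (suc k) = trans (periodic l (k * N)) (multiple k)

    multiple : ∀ {s} → Line s → ∀ k b → s (k * N + b) ≡ s b
    multiple l zero    b = refl
    multiple {s} l (suc k) b = trans (cong s (+-assoc N (k * N) b)) (trans (periodic l (k * N + b)) (multiple l k b))

    κ^-multiple : ∀ k x → κ^ (k * N) x ≡ x
    κ^-multiple zero    x = refl
    κ^-multiple (suc k) x = trans (κ^-+ N (k * N) x) (trans (κ^-multiple k (κ^ N x)) (κ^N x))

    W-line-from : ∀ {s} → Line s → ∀ k b → W (replicate k m) (s b) (s (k + b))
    W-line-from l k b = W-line (shift-line b l) k

    -- A shortcut would close with the remaining `suc c` arcs, of which there is at least one, to a
    -- walk too short for type `m`.
    line-dist : ∀ {s} → Line s → ∀ b c i → b + suc c ≡ N → dist (s i) (s (b + i)) ≡ b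
    line-dist {s} l b c i e with geodesic _ {s i} {s (b + i)} refl
    ... | L , len , w = ≤-antisym
          (subst (dist (s i) (s (b + i)) ≤_) (length-replicate b) (W-length (replicate b m) (W-line-from l b i)))
          (+-cancelʳ-≤ (suc c) b _ (begin
            b + suc c                                ≡⟨ e ⟩
            N                                        ≤⟨ Cl-length∈ (here refl) (Cl-++ (replicate (suc c) m) back w) ⟩
            length (replicate (suc c) m ++ L)        ≡⟨ length-++ (replicate (suc c) m) ⟩
            length (replicate (suc c) m) + length L  ≡⟨ cong₂ _+_ (length-replicate (suc c)) len ⟩
            suc c + dist (s i) (s (b + i))           ≡⟨ +-comm (suc c) _ ⟩
            dist (s i) (s (b + i)) + suc c           ∎))
      where
      open ≤-Reasoning
      back : W (replicate (suc c) m) (s (b + i)) (s i)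
      back = subst (W (replicate (suc c) m) (s (b + i)))
        (trans (cong s (trans (sym (+-assoc (suc c) b i)) (cong (_+ i) (trans (+-comm (suc c) b) e)))) (periodic l i))
        (W-line-from l (suc c) (b + i))

    line-rel : ∀ {s} → Line s → ∀ b c i → suc b + suc c ≡ N → rel (s i) (s (suc b + i)) ≡ (suc b , suc c)
    line-rel {s} l b c i e = cong₂ _,_ (line-dist l (suc b) c i e)
      (subst (λ v → dist (s (suc b + i)) v ≡ suc c)
        (trans (cong s (trans (sym (+-assoc (suc c) (suc b) i)) (cong (_+ i) (trans (+-comm (suc c) (suc b)) e)))) (periodic l i))
        (line-dist l (suc c) b (suc b + i) (trans (+-comm (suc c) (suc b)) e)))

    shift-rel : ∀ {s} → Line s → ∀ b i → b < N → rel (s i) (s (b + i)) ≡ rel (s 0) (s b)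
    shift-rel {s} l zero    i b< = trans (rel-refl (s i)) (sym (rel-refl (s 0)))
    shift-rel {s} l (suc b) i b< with m≤n⇒∃[o]m+o≡n b<
    ... | c , e = trans (line-rel l b c i e′)
          (sym (subst (λ v → rel (s 0) (s (suc v)) ≡ (suc b , suc c)) (+-identityʳ b) (line-rel l b c 0 e′)))
      where
      e′ : suc b + suc c ≡ N
      e′ = trans (+-suc (suc b) c) e

    side-arc : ∀ {s} → Line s → ∀ b → Arc m (s b) (κ (s (2 + j + b)))
    side-arc {s} l b = turn R∈ (subst (Arc m (s (2 + j + b))) (periodic l b) (step l (2 + j + b)))

    ahead : ∀ {s} → Line s → ∀ b → rel (s (2 + j + b)) (s (suc b)) ≡ g
    ahead {s} l b = subst (λ v → rel (s (2 + j + b)) v ≡ g)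
      (trans (cong s (sym (+-suc N b))) (periodic l (suc b))) (straight l (2 + j + b))

    -- The straight continuation and the turn. The index `2 + j + b` is `b - 1` modulo the period,
    -- so walks never leave the vertices `κ^ a (s b)`.
    successors : ∀ {s} → Line s → ∀ a b {y} → Arc m (κ^ a (s b)) y →
                 y ≡ κ^ a (s (suc b)) ⊎ y ≡ κ^ (suc a) (s (2 + j + b))
    successors {s} l a b = third
      (≢-rel {κ^ a (s (2 + j + b))} (trans (κ^-auto a (s (2 + j + b)) (s (suc b))) (ahead l b))
             (trans (κ^-auto a (s (2 + j + b)) (κ (s (2 + j + b)))) (κ-rel (s (2 + j + b))))
             (R≢g ∘ sym))
      (trans (κ^-auto a (s b) (s (suc b))) (step l b))
      (trans (κ^-auto a (s b) (κ (s (2 + j + b)))) (side-arc l b))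

    walk-endpoint : ∀ {s} → Line s → ∀ k {a b y} → W (replicate k m) (κ^ a (s b)) y →
                    ∃ λ a′ → ∃ λ b′ → y ≡ κ^ a′ (s b′)
    walk-endpoint l zero    {a} {b} w = a , b , sym w
    walk-endpoint {s} l (suc k) {a} {b} {y} (v , e , w) =
      [ (λ q → walk-endpoint l k {a} {suc b} (subst (λ v → W (replicate k m) v y) q w))
      , (λ q → walk-endpoint l k {suc a} {2 + j + b} (subst (λ v → W (replicate k m) v y) q w)) ]′
      (successors l a b e)

    -- The endpoint of a walk of arcs of type m from s 0 is κ^ a (s b) for some a and b, and the
    -- map κ^ i (s j) ↦ κ^ (a + i) (s (b + j)) has order dividing N.
    module _ {s : ℕ → Vertex} (l : Line s) {r a b : ℕ} (b< : b < N) (ab : rel (s 0) (κ^ a (s b)) ≡ (r , 1)) where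

      private
        u : ℕ → Vertex
        u k = κ^ (k * a) (s (k * b))

        u-arc : ∀ k → Arc r (u (suc k)) (u k)
        u-arc k = op (trans (cong (rel (u k)) (κ^-+ a (k * a) (s (b + k * b))))
          (trans (κ^-auto (k * a) (s (k * b)) (κ^ a (s (b + k * b))))
          (trans (κ^-resp a (shift-rel l b (k * b) b<)) ab)))

        u-walk : ∀ k → W (replicate k r) (u k) (u 0)
        u-walk zero    = refl
        u-walk (suc k) = u k , u-arc k , u-walk k

        u-N : u N ≡ u 0
        u-N = trans (cong₂ (λ i k → κ^ i (s k)) (*-comm N a) (trans (*-comm N b) (sym (+-identityʳ (b * N)))))
                    (trans (κ^-multiple a (s (b * N + 0))) (multiple l b 0))

      lattice-cycle : Cl (replicate N r)
      lattice-cycle = u 0 , subst (λ v → W (replicate N r) v (u 0)) u-N (u-walk N)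

    -- The end is a lattice point, so the displacement from `x` to `y` has order dividing `N`. Read
    -- backwards, its repetitions are arcs of type `r`, and `N` of them close up, too few if
    -- `N ≤ r`.
    walk-end-order : ∀ {r x y} k → W (replicate k m) x y → rel x y ≡ (r , 1) → N ≤ r → ⊥
    walk-end-order {r} {x} {y} k w xy N≤r = short cycle
      where
      line : ∃ λ s → Line s × s 0 ≡ x
      line = line-from x
      s : ℕ → Vertex
      s = proj₁ line
      l : Line s
      l = proj₁ (proj₂ line)
      end : ∃ λ a → ∃ λ b → y ≡ κ^ a (s b)
      end = walk-endpoint l k {0} {0} (subst (λ v → W (replicate k m) v y) (sym (proj₂ (proj₂ line))) w)
      a b₀ : ℕ
      a = proj₁ end
      b₀ = proj₁ (proj₂ end)
      reduce : s b₀ ≡ s (b₀ % N)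
      reduce = trans (cong s (trans (m≡m%n+[m/n]*n b₀ N) (+-comm (b₀ % N) (b₀ / N * N))))
                     (multiple l (b₀ / N) (b₀ % N))
      cycle : Cl (replicate N r)
      cycle = lattice-cycle l {r} {a} {b₀ % N} (m%n<n b₀ N)
        (trans (cong₂ rel (proj₂ (proj₂ line)) (trans (cong (κ^ a) (sym reduce)) (sym (proj₂ (proj₂ end))))) xy)
      short : Cl (replicate N r) → ⊥
      short c = <⇒≱ (subst (r <_) (length-replicate N) (Cl-length∈ (here refl) c)) N≤r

-- Arc types in the square of an arc type

module ArcSquares (S : Scheme) where
  open Translations S public

  Sq-pure : ∀ k → Good (1 + k) → Sq (2 + k) (1 + k) → Pureᶜ (1 + k)
  Sq-pure zero    _    _  = pure-one
  Sq-pure (suc k) good sq = square-pure good sq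

  Sq-≥ : ∀ {r s} → Sq r s → r ≤ suc s
  Sq-≥ {r} (x , y , z , xy , yz , xz) = subst (r ≤_) (cong suc (bwd xz)) (back≥ xy (fwd yz))

  circuit-at : ∀ {r x y} → Arc r x y → ∃ λ M → length M ≡ r × W M y x
  circuit-at xy = geodesic _ (bwd xy)

  -- If `g` is thin, so is `(1 , 2 + k)`, which leaves no room for two continuations of an arc. If
  -- `(1 , s)` is thin, `κ^N` closes a walk of `3 + k` arcs of type `s`.
  pure-case : ∀ {k s} → 3 + k ≤ s → Sq (2 + k) s → Cl (replicate (3 + k) (2 + k)) → ⊥
  pure-case {k} {s} s≥ sq cl = [ thin-g , thin-s ]′ (square-thin (λ ()) g∈ sq)
    where
    m = 2 + k
    g = 2 , 1 + k
    g∈ : g ∈² (1 , m)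
    g∈ = let (x , y , xy , z , yz , w) = cl in x , y , z , xy , yz , pure-square xy yz w
    thin-g : Thin g → ⊥
    thin-g t =
      let (x , y , xy , _) = cl
          z , yz , xz = next² g∈ xy
          z′ , yz′ , xz′ = next² sq xy
      in ≢-rel xz xz′ (λ ()) (pure-square-thin cl t yz yz′)
    thin-s : Thin (1 , s) → ⊥
    thin-s t = <⇒≱ (subst (s <_) (length-replicate (3 + k)) (Cl-length∈ (here refl) closed)) s≥
      where
      open Lattice cl t sq (λ ())
      x : Vertex
      x = proj₁ cl
      closed : Cl (replicate (3 + k) s)
      closed = x , subst (W (replicate (3 + k) s) x) (κ^N x) (W-κ refl (3 + k) x)

  -- Turning the arcs `(y₁ , z)` and `(y₀ , y₁)` leads from `z` to `κ (κ y₀)`, and this composite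
  -- must again have type `s`. By purity `κ` has order dividing `2 + k`, so `k` further arcs return
  -- to `y₀`.
  mixed-thin-c : ∀ {k s} → 3 + k ≤ s → Sq (2 + k) s → Sq (2 + k) (1 + k) → Pureᶜ (1 + k) →
                 Thin (1 , 1 + k) → ⊥
  mixed-thin-c {k} {s} s≥ sq sqc pc t = <⇒≱ s≥ (begin
      s                            ≡⟨ bwd y₀z ⟨
      dist z y₀                    ≤⟨ dist-arc y₀ zw ⟩
      suc (dist (κ (κ y₀)) y₀)     ≤⟨ s≤s (subst (dist (κ (κ y₀)) y₀ ≤_) (length-replicate k) (W-length (replicate k (1 + k)) back)) ⟩
      suc k                        ≤⟨ n≤1+n _ ⟩
      2 + k                        ∎)
    where
    open ≤-Reasoning
    y₀ y₁ : Vertex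
    y₀ = proj₁ sqc
    y₁ = proj₁ (proj₂ sqc)
    y₀y₁ : Arc (2 + k) y₀ y₁
    y₀y₁ = proj₁ (proj₂ (proj₂ (proj₂ sqc)))
    open Translation t (proj₂ (proj₂ (proj₂ (proj₂ (proj₂ sqc)))))
    z : Vertex
    z = proj₁ (next² sq y₀y₁)
    y₁z : Arc (2 + k) y₁ z
    y₁z = proj₁ (proj₂ (next² sq y₀y₁))
    y₀z : Arc s y₀ z
    y₀z = proj₂ (proj₂ (next² sq y₀y₁))
    c≢s : 1 + k ≢ s
    c≢s e = <⇒≱ s≥ (≤-trans (≤-reflexive (sym e)) (n≤1+n _))
    zw : Arc s z (κ (κ y₀))
    zw = [ (λ p → ⊥-elim (c≢s (arc-inj (subst (Arc (1 + k) y₀) (κ-injective (κ-unique p)) (κ-rel y₀)) y₀z)))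
         , (λ p → p) ]′
         (square-dichotomy (arc≢ c≢s) sqc sq (turn sqc y₁z) (κ-arc (turn sqc y₀y₁)))
    cycle : W (replicate (2 + k) (1 + k)) y₀ y₀
    cycle = κ y₀ , κ-rel y₀ , pure-cycle pc (κ-rel y₀)
    back : W (replicate k (1 + k)) (κ (κ y₀)) y₀
    back = subst (W (replicate k (1 + k)) (κ (κ y₀))) (sym (W-κ⁻ refl (2 + k) cycle)) (W-κ refl k (κ (κ y₀)))

  -- Two steps of the translation by type `2 + s` equal two arcs of type `1 + k`. On a pure circuit
  -- of type `2 + s` this substitution introduces a foreign type; on a mixed one the two steps form
  -- an arc of type `1 + s`, which the hypothesis on `Sq (1 + k) (1 + s)` excludes.
  mixed-thin-s : ∀ {k s} → 1 + k ≤ s → Good (2 + s) → Sq (2 + k) (2 + s) → Sq (2 + k) (1 + k) →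
                 ¬ Sq (1 + k) (1 + s) → Thin (1 , 2 + s) → ⊥
  mixed-thin-s {k} {s} s≥ good sq sqc ih t = case (good _ (proj₁ (proj₂ circ)) (x₀ , κ x₀ , κ-rel x₀ , proj₂ (proj₂ circ)))
                                                  (proj₁ (proj₂ circ)) (proj₂ (proj₂ circ))
    where
    c≢s : 1 + k ≢ 2 + s
    c≢s e = <⇒≱ s≥ (≤-trans (n≤1+n _) (≤-reflexive (suc-injective (sym e))))
    x₀ : Vertex
    x₀ = proj₁ sq
    open Translation t (proj₂ (proj₂ (proj₂ (proj₂ (proj₂ sq)))))
    succ : ∀ x → ∃ λ y → Arc (2 + k) x y
    succ x = let (a , b , _ , ab , _) = sq
                 y , p , _ = mid (rel-refl a) (rel-refl x) ab (op ab)
             in y , p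
    c²∋κ² : ∀ x → ∃ λ y → Arc (1 + k) x y × Arc (1 + k) y (κ (κ x))
    c²∋κ² x =
      let x₁ , xx₁ = succ x
          x₂ , x₁x₂ , xx₂ = next² sqc xx₁
      in x₂ , xx₂ ,
         [ (λ p → p)
         , (λ p → ⊥-elim (c≢s (arc-inj xx₂ (subst (Arc (2 + s) x) (κ-injective (κ-unique p)) (κ-rel x))))) ]′
         (square-dichotomy (arc≢ c≢s) sqc sq (turn sq x₁x₂) (κ-arc (turn sq xx₁)))
    circ : ∃ λ M → length M ≡ 2 + s × W M (κ x₀) x₀
    circ = circuit-at (κ-rel x₀)
    types : ∀ {N} → All (λ t → t ≡ 2 + s ⊎ suc t ≡ 2 + s) (1 + k ∷ N) → ⊥
    types (inj₁ e ∷ _) = c≢s e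
    types (inj₂ e ∷ _) = <⇒≱ s≥ (≤-reflexive (suc-injective (suc-injective (sym e))))
    N : List ℕ
    N = replicate s (2 + s)
    replaced : W (2 + s ∷ 2 + s ∷ N) (κ x₀) x₀ → Cl (2 + s ∷ 1 + k ∷ 1 + k ∷ N)
    replaced (z , a , w) =
      let y , p , q = c²∋κ² x₀
      in Cl-perm {l = 1 + k ∷ 1 + k ∷ 2 + s ∷ N} (↭.trans (prep _ (swap _ _ ↭.refl)) (swap _ _ ↭.refl))
                 (x₀ , y , p , κ (κ x₀) , q , subst (λ v → W (2 + s ∷ N) v x₀) (κ-unique a) w)
    case : ∀ {M} → Circuit (2 + s) M → length M ≡ 2 + s → W M (κ x₀) x₀ → ⊥
    case (mixed _ sq′) _ _ =
      let y , a , b = c²∋κ² x₀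
          z , p , q = next² sq′ (κ-rel x₀)
      in ih (x₀ , y , κ (κ x₀) , a , b , subst (Arc (1 + s) x₀) (κ-unique p) q)
    case (pure a) len w = types (circuit-types (good _ (cong (2 +_) (length-replicate s))
      (replaced (subst (λ l → W l (κ x₀) x₀) (trans (All≡⇒replicate a) (cong (λ n → replicate n (2 + s)) len)) w))))

  sq-type : ∀ B → (∀ m → m < B → 1 ≤ m → Good m) →
            ∀ k s → 2 + k < B → s < B → Sq (2 + k) s → s ≡ 1 + k
  sq-type B good k s k< s< sq = by-order (<-cmp s (2 + k))
    where
    sq≥3 : ∀ {s} → 3 + k ≤ s → s < B → Sq (2 + k) s → ⊥
    sq≥3 {suc (suc s)} (s≤s (s≤s s≥)) s< sq = by-circuit (good (2 + k) k< (s≤s z≤n) _ (proj₁ (proj₂ circ)) (x , y , xy , proj₂ (proj₂ circ)))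
                                     (proj₁ (proj₂ circ)) (proj₂ (proj₂ circ))
      where
      x y : Vertex
      x = proj₁ sq
      y = proj₁ (proj₂ sq)
      xy : Arc (2 + k) x y
      xy = proj₁ (proj₂ (proj₂ (proj₂ sq)))
      circ : ∃ λ M → length M ≡ 2 + k × W M y x
      circ = circuit-at xy
      good-c : Good (1 + k)
      good-c = good (1 + k) (<-trans (n<1+n _) k<) (s≤s z≤n)
      lower : ∀ k′ → k ≡ k′ → ¬ Sq (1 + k) (1 + s)
      lower zero     refl sq′ = contradiction (subst (1 ≤_) (suc-injective (Sq-one sq′)) s≥) λ ()
      lower (suc k′) refl sq′ =
        <⇒≢ (≤-trans (n≤1+n _) s≥) (sym (suc-injective (sq-type B good k′ (1 + s) (<-trans (n<1+n _) k<) (<-trans (n<1+n _) s<) sq′)))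
      by-circuit : ∀ {M} → Circuit (2 + k) M → length M ≡ 2 + k → W M y x → ⊥
      by-circuit (pure a) len w = pure-case (s≤s (s≤s s≥)) sq
        (x , y , xy , subst (λ l → W l y x) (trans (All≡⇒replicate a) (cong (λ n → replicate n (2 + k)) len)) w)
      by-circuit (mixed _ sqc) _ _ =
        [ mixed-thin-c (s≤s (s≤s s≥)) sq sqc (Sq-pure k good-c sqc)
        , mixed-thin-s s≥ (good (2 + s) s< (s≤s z≤n)) sq sqc (lower k refl) ]′
        (square-thin (arc≢ (λ e → <⇒≢ (≤-trans s≥ (n≤1+n s)) (suc-injective e))) sqc sq)
    by-order : Tri (s < 2 + k) (s ≡ 2 + k) (2 + k < s) → s ≡ 1 + k
    by-order (tri< s<2+k _ _) = ≤-antisym (s≤s⁻¹ s<2+k) (s≤s⁻¹ (Sq-≥ sq))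
    by-order (tri≈ _ refl _) = ⊥-elim (Sq-irrefl (s≤s (s≤s z≤n)) sq)
    by-order (tri> _ _ s>) = ⊥-elim (sq≥3 s> s< sq)

-- Shortest return paths along arcs of one type

module PowerWalks (S : Scheme) where
  open ArcSquares S public

  square-other : ∀ {E R₁ R₂ x y z} → R₁ ≢ R₂ → R₁ ∈² E → R₂ ∈² E →
                 rel x y ≡ E → rel y z ≡ E → rel x z ≢ R₁ → rel x z ≡ R₂
  square-other R₁≢R₂ s₁ s₂ p q ≢R₁ with square-dichotomy R₁≢R₂ s₁ s₂ p q
  ... | inj₁ e = ⊥-elim (≢R₁ e)
  ... | inj₂ e = e

  thin-first : ∀ {P Q} → ¬ Thin Q → Thin P ⊎ Thin Q → Thin P
  thin-first ¬q (inj₁ t) = t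
  thin-first ¬q (inj₂ t) = ⊥-elim (¬q t)

  vertices : ∀ {e} k {x y} → W (replicate k e) x y →
             ∃ λ (s : ℕ → Vertex) → s 0 ≡ x × s k ≡ y × (∀ i → i < k → Arc e (s i) (s (suc i)))
  vertices zero    {x} refl = (λ _ → x) , refl , refl , λ _ ()
  vertices {e} (suc k) {x} (z , a , w) with vertices k w
  ... | s , refl , end , step = s′ , refl , end , step′
    where
    s′ : ℕ → Vertex
    s′ zero    = x
    s′ (suc i) = s i
    step′ : ∀ i → i < suc k → Arc e (s′ i) (s′ (suc i))
    step′ zero    _ = a
    step′ (suc i) (s≤s i<) = step i i<

  -- A walk x₁ = s 0, …, s r = x₀ of r arcs of type e back to the tail of an arc (x₀ , x₁) of type r.
  module ReturnPath {r e : ℕ} (s : ℕ → Vertex) (step : ∀ i → i < r → Arc e (s i) (s (suc i)))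
                    (ret : rel (s 0) (s r) ≡ (r , 1)) where

    segment : ∀ k i → k + i ≤ r → dist (s i) (s (k + i)) ≤ k
    segment zero    i le = ≤-reflexive (dist-refl (s i))
    segment (suc k) i le = ≤-trans (dist-arc′ (s i) (step (k + i) le)) (s≤s (segment k i (≤-trans (n≤1+n _) le)))

    geo : ∀ k i l → l + (k + i) ≡ r → dist (s i) (s (k + i)) ≡ k
    geo k i l e = ≤-antisym (segment k i (≤-trans (m≤n+m _ l) (≤-reflexive e)))
      (+-cancelˡ-≤ i k _ (+-cancelʳ-≤ l _ _ (begin
        i + k + l                                              ≡⟨ cong (_+ l) (+-comm i k) ⟩
        k + i + l                                              ≡⟨ +-comm (k + i) l ⟩
        l + (k + i)                                            ≡⟨ trans e (sym (fwd ret)) ⟩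
        dist (s 0) (s r)                                       ≤⟨ triangle (s 0) (s (k + i)) (s r) ⟩
        dist (s 0) (s (k + i)) + dist (s (k + i)) (s r)        ≤⟨ +-mono-≤ (triangle (s 0) (s i) (s (k + i))) last ⟩
        dist (s 0) (s i) + dist (s i) (s (k + i)) + l          ≤⟨ +-monoˡ-≤ l (+-monoˡ-≤ _ first) ⟩
        i + dist (s i) (s (k + i)) + l                         ∎)))
      where
      open ≤-Reasoning
      last : dist (s (k + i)) (s r) ≤ l
      last = subst (λ v → dist (s (k + i)) (s v) ≤ l) e (segment l (k + i) (≤-reflexive e))
      first : dist (s 0) (s i) ≤ i
      first = subst (λ v → dist (s 0) (s v) ≤ i) (+-identityʳ i)
        (segment i 0 (subst (_≤ r) (sym (+-identityʳ i)) (≤-trans (m≤n+m i k) (≤-trans (m≤n+m _ l) (≤-reflexive e)))))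

    geo₀ : ∀ k l → l + k ≡ r → dist (s 0) (s k) ≡ k
    geo₀ k l e = subst (λ v → dist (s 0) (s v) ≡ k) (+-identityʳ k)
                   (geo k 0 l (trans (cong (l +_) (+-identityʳ k)) e))

  -- Read backwards, the path is again straight up to translation by κ: if (u , v) is an arc of
  -- type e, then so is (v , κ u).  Hence rel (s 0) (s r) = rel (s r) (κ^ r (s 0)).
  module Reversal {r e : ℕ} (s : ℕ → Vertex) (step : ∀ i → i < 3 + r → Arc e (s i) (s (suc i)))
                  (ret : rel (s 0) (s (3 + r)) ≡ (3 + r , 1))
                  {R : ℕ × ℕ} (R∈ : R ∈² (1 , e)) (R≤1 : proj₁ R ≤ 1) where
    open ReturnPath s step ret

    Y : ℕ × ℕ
    Y = rel (s 0) (s 2)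

    Y∈ : Y ∈² (1 , e)
    Y∈ = s 0 , s 1 , s 2 , step 0 (s≤s z≤n) , step 1 (s≤s (s≤s z≤n)) , refl

    R≢Y : R ≢ Y
    R≢Y refl = <⇒≱ (≤-reflexive (sym (geo₀ 2 (1 + r) (+-comm (1 + r) 2)))) R≤1

    straight : ∀ i l → l + (2 + i) ≡ 3 + r → rel (s i) (s (2 + i)) ≡ Y
    straight i l e = square-other R≢Y R∈ Y∈ (step i (<-trans (n<1+n i) 1+i<)) (step (suc i) 1+i<)
      (λ p → <⇒≱ (≤-reflexive (trans (sym (geo 2 i l e)) (cong proj₁ p))) R≤1)
      where
      1+i< : suc i < 3 + r
      1+i< = ≤-trans (m≤n+m _ l) (≤-reflexive e)

    -- Thinness would let another successor `v` of `s 0` lead to `s 2`. Its distance to `s 3` rules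
    -- out `R` for `(v , s 3)`, so `v` and `s 1` would share the relation `Y` to `s 3`.
    Y-not-thin : ¬ Thin Y
    Y-not-thin t =
      let a₀ = step 0 (s≤s z≤n)
          a₁ = step 1 (s≤s (s≤s z≤n))
          a₂ = step 2 (s≤s (s≤s (s≤s z≤n)))
          u , a₁′ , p = next² R∈ a₀
          v , v≢s₁ , s₀v = another {y = s 0} {c = s 1} (≢-rel p refl R≢Y) a₁′ a₁
          w , vw , s₀w = next² Y∈ s₀v
          vs₂ = subst (Arc e v) (t s₀w refl) vw
          far : dist v (s 3) ≤ 1 → ⊥
          far le = <⇒≱ (≤-reflexive (sym (geo₀ 3 r (+-comm r 3))))
                       (≤-trans (dist-arc (s 3) s₀v) (s≤s le))
          vs₃ = square-other R≢Y R∈ Y∈ vs₂ a₂ (λ q → far (subst (_≤ 1) (sym (cong proj₁ q)) R≤1))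
      in v≢s₁ (thinᵒ t vs₃ (straight 1 r (+-comm r 3)))

    opaque
      thin : Thin R
      thin = thin-first Y-not-thin (square-thin R≢Y R∈ Y∈)

    open Translation thin (proj₂ (proj₂ (proj₂ (proj₂ (proj₂ R∈))))) public

    Y-unique : ∀ {x y z z′} → Arc e x y → Arc e y z → rel x z ≡ Y → Arc e y z′ → rel x z′ ≡ Y → z′ ≡ z
    Y-unique {z = z} {z′} xy yz xz yz′ xz′ =
      let u , yu , xu = next² R∈ xy
      in [ (λ q → ⊥-elim (R≢Y (trans (sym (subst (λ v → rel _ v ≡ R) (sym q) xu)) xz′))) , (λ q → q) ]′
         (third (≢-rel xu xz R≢Y) yu yz yz′)

    back-arc : ∀ i {j} → j < 3 + r → Arc e (κ^ i (s (suc j))) (κ^ (suc i) (s j))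
    back-arc i {j} j< = trans (κ^-auto i (s (suc j)) (κ (s j))) (turn R∈ (step j j<))

    no-turn : ∀ {j} l → l + (2 + j) ≡ 3 + r → rel (s (2 + j)) (κ (κ (s j))) ≢ R
    no-turn {j} l q p = R≢Y (trans (sym (κ-rel (s j)))
        (trans (cong (rel (s j)) (κ-injective {κ (s j)} {s (2 + j)} (κ-unique p))) (straight j l q)))

    back-square : ∀ {j} → suc j < 3 + r → rel (s (2 + j)) (κ (κ (s j))) ≢ R → rel (s (2 + j)) (κ (κ (s j))) ≡ Y
    back-square {j} 1+j< = square-other R≢Y R∈ Y∈ (turn R∈ (step (suc j) 1+j<))
               (κ-arc (turn R∈ (step j (<-trans (n<1+n j) 1+j<))))

    back-straight : ∀ i {j} l → l + (2 + j) ≡ 3 + r → rel (κ^ i (s (2 + j))) (κ^ (2 + i) (s j)) ≡ Y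
    back-straight i {j} l q = trans (κ^-auto i (s (2 + j)) (κ (κ (s j))))
      (back-square (≤-trans (m≤n+m _ l) (≤-reflexive q)) (no-turn l q))

    -- From the preceding vertex the reversed path continues straight or by `R`; by `R`, the
    -- distance from `s (3 + r)` to `w` would be at most `1 + i`.
    next-vertex : ∀ i {j w} → i + (2 + j) ≡ 3 + r →
                  rel (s 0) (s i) ≡ rel (s (3 + r)) (κ^ i (s (2 + j))) →
                  rel (s (3 + r)) w ≡ rel (s 0) (s (2 + i)) → Arc e (κ^ (1 + i) (s (1 + j))) w →
                  w ≡ κ^ (2 + i) (s j)
    next-vertex i {j} {w} eq ih pw aw =
      Y-unique (back-arc i j<′) (back-arc (suc i) j<) (back-straight i i eq) aw
        (square-other R≢Y R∈ Y∈ (back-arc i j<′) aw near)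
      where
      open ≤-Reasoning
      j<′ : suc j < 3 + r
      j<′ = ≤-trans (m≤n+m (2 + j) i) (≤-reflexive eq)
      j< : j < 3 + r
      j< = <-trans (n<1+n j) j<′
      near : rel (κ^ i (s (2 + j))) w ≡ R → ⊥
      near p = <⇒≱ (n<1+n (1 + i)) (begin
        2 + i                                     ≡⟨ geo₀ (2 + i) j (trans (+-comm j (2 + i)) (trans (sym (trans (+-suc i (suc j)) (cong suc (+-suc i j)))) eq)) ⟨
        dist (s 0) (s (2 + i))                    ≡⟨ cong proj₁ pw ⟨
        dist (s (3 + r)) w                        ≤⟨ triangle (s (3 + r)) (κ^ i (s (2 + j))) w ⟩
        dist (s (3 + r)) (κ^ i (s (2 + j))) + dist (κ^ i (s (2 + j))) w
          ≡⟨ cong₂ _+_ (sym (cong proj₁ ih)) (cong proj₁ p) ⟩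
        dist (s 0) (s i) + proj₁ R                ≡⟨ cong (_+ proj₁ R) (geo₀ i (2 + j) (trans (+-comm (2 + j) i) eq)) ⟩
        i + proj₁ R                               ≤⟨ +-monoʳ-≤ i R≤1 ⟩
        i + 1                                     ≡⟨ +-comm i 1 ⟩
        1 + i                                     ∎)

    next-rel : ∀ i j → i + (2 + j) ≡ 3 + r →
               rel (s 0) (s i) ≡ rel (s (3 + r)) (κ^ i (s (2 + j))) →
               rel (s 0) (s (1 + i)) ≡ rel (s (3 + r)) (κ^ (1 + i) (s (1 + j))) →
               rel (s 0) (s (2 + i)) ≡ rel (s (3 + r)) (κ^ (2 + i) (s j))
    next-rel i j eq ih ih′
      with right refl (sym ih′) refl (step (suc i)
             (≤-trans (m≤m+n (2 + i) j) (≤-reflexive (trans (sym (trans (+-suc i (suc j)) (cong suc (+-suc i j)))) eq))))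
    ... | w , pw , aw = trans (sym pw) (cong (rel (s (3 + r))) (next-vertex i eq ih pw aw))

    reverse : ∀ i j → i + j ≡ 3 + r → rel (s 0) (s i) ≡ rel (s (3 + r)) (κ^ i (s j))
    reverse zero .(3 + r) refl = trans (rel-refl (s 0)) (sym (rel-refl (s (3 + r))))
    reverse (suc zero) .(2 + r) refl = trans (step 0 (s≤s z≤n)) (sym (back-arc 0 ≤-refl))
    reverse (suc (suc i)) j eq = next-rel i j e₂ (reverse i (2 + j) e₂) (reverse (suc i) (suc j) e₁)
      where
      e₁ : suc i + suc j ≡ 3 + r
      e₁ = trans (cong suc (+-suc i j)) eq
      e₂ : i + (2 + j) ≡ 3 + r
      e₂ = trans (+-suc i (suc j)) e₁

    -- By `reverse`, one arc leads from the translate to `s (3 + r)`, which is `3 + r` away from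
    -- `s 0`. The contradiction will come from translations with short orbits.
    far-translate : 2 + r ≤ dist (s 0) (κ^ (3 + r) (s 0))
    far-translate = s≤s⁻¹ (begin
        3 + r                                       ≡⟨ fwd ret ⟨
        dist (s 0) (s (3 + r))                      ≤⟨ dist-arc′ (s 0) arc-back ⟩
        suc (dist (s 0) (κ^ (3 + r) (s 0)))         ∎)
      where
      open ≤-Reasoning
      arc-back : Arc (3 + r) (κ^ (3 + r) (s 0)) (s (3 + r))
      arc-back = op (trans (sym (reverse (3 + r) 0 (+-identityʳ _))) ret)

-- No return walk of a single smaller type

module NoPowerWalk (S : Scheme) where
  open PowerWalks S public

  _≟ᴿ_ : (P Q : ℕ × ℕ) → Dec (P ≡ Q)
  _≟ᴿ_ = ≡-dec _≟_ _≟_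

  replicate-all : ∀ {r : ℕ} {k M} → All (_≡ r) M → length M ≡ k → M ≡ replicate k r
  replicate-all {r} a refl = All≡⇒replicate a

  module _ {r : ℕ} (s : ℕ → Vertex) where

    -- Here `R` is the diagonal and the translation is the identity.
    type-one : (∀ i → i < 3 + r → Arc 1 (s i) (s (suc i))) → rel (s 0) (s (3 + r)) ≢ (3 + r , 1)
    type-one step ret = contradiction far-translate
      (<⇒≱ (subst (_< 2 + r) (sym (trans (cong (dist (s 0)) (fixed (3 + r))) (dist-refl (s 0)))) (s≤s z≤n)))
      where
      a : Arc 1 (s 0) (s 1)
      a = step 0 (s≤s z≤n)
      open Reversal s step ret {0 , 0} (s 0 , s 1 , s 0 , a , op a , rel-refl (s 0)) z≤n
      fixed : ∀ k → κ^ k (s 0) ≡ s 0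
      fixed zero    = refl
      fixed (suc k) = trans (cong (κ^ k) (sym (κ-unique (rel-refl (s 0))))) (fixed k)

    -- The translation is by the pure type `1 + k`: its orbits close after `2 + k` arcs, so no power
    -- moves a vertex by more than `1 + k`.
    type-mixed : ∀ {k} → k ≤ r → Pureᶜ (1 + k) → Sq (2 + k) (1 + k) →
                 (∀ i → i < 3 + r → Arc (2 + k) (s i) (s (suc i))) → rel (s 0) (s (3 + r)) ≢ (3 + r , 1)
    type-mixed {k} k≤r pc sq step ret = <⇒≱ far-translate (≤-trans (short (3 + r) (s 0)) (s≤s k≤r))
      where
      open Reversal s step ret sq ≤-refl
      period : ∀ x → κ^ (2 + k) x ≡ x
      period x = sym (W-κ⁻ refl (2 + k) (κ x , κ-rel x , pure-cycle pc (κ-rel x)))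
      reduce : ∀ q i x → κ^ (i + q * (2 + k)) x ≡ κ^ i x
      reduce zero    i x = cong (λ t → κ^ t x) (+-identityʳ i)
      reduce (suc q) i x = trans (cong (λ t → κ^ t x) (trans (+-comm i _) (trans (+-assoc (2 + k) (q * (2 + k)) i)
          (cong (2 + k +_) (+-comm (q * (2 + k)) i)))))
        (trans (κ^-+ (2 + k) (i + q * (2 + k)) x) (trans (cong (κ^ (i + q * (2 + k))) (period x)) (reduce q i x)))
      short : ∀ t x → dist x (κ^ t x) ≤ 1 + k
      short t x = subst (λ v → dist x v ≤ 1 + k)
        (sym (trans (cong (λ i → κ^ i x) (m≡m%n+[m/n]*n t (2 + k))) (reduce (t / (2 + k)) (t % (2 + k)) x)))
        (≤-trans (W-length (replicate (t % (2 + k)) (1 + k)) (W-κ refl (t % (2 + k)) x))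
          (≤-trans (≤-reflexive (length-replicate (t % (2 + k)))) (s≤s⁻¹ (m%n<n t (2 + k)))))

    module _ {k} (all-g : ∀ {x y z} → Arc (2 + k) x y → Arc (2 + k) y z → rel x z ≡ (2 , 1 + k)) where

      -- Under `all-g` the successors of `y` and of `y′` are all `g`-neighbours of `x`, and there
      -- are at most two of these.
      same-succ : ∀ {x y y′ v} → Arc (2 + k) x y → Arc (2 + k) x y′ → Arc (2 + k) y v → Arc (2 + k) y′ v
      same-succ {x} {y} {y′} {v} a a′ b with y Fin.≟ y′
      ... | yes refl = b
      ... | no y≢y′ with distinct {y = y′} y≢y′ a a′
      ...   | c , d , c≢d , p , q with third c≢d (all-g a′ p) (all-g a′ q) (all-g a b)
      ...     | inj₁ refl = p
      ...     | inj₂ refl = q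

      -- By `same-succ` the closed walk on the first arc is bent onto the path, which yields an arc
      -- from `s (2 + k)` to `s 0`. If `k < r`, then `s (4 + k)` becomes a successor of `s 0`;
      -- otherwise `s 0` and `s (3 + k)` share a predecessor and are symmetric.
      type-pure : k ≤ r → Cl (replicate (3 + k) (2 + k)) →
                  (∀ i → i < 3 + r → Arc (2 + k) (s i) (s (suc i))) → rel (s 0) (s (3 + r)) ≢ (3 + r , 1)
      type-pure k≤r (x₀ , x₁ , a₀ , w₀) step ret =
        [ longer , (λ e → sym-ret (subst (λ t → rel (s 0) (s (3 + t)) ≡ rel (s (3 + t)) (s 0)) e (symOut last last′))) ]′
        (m≤n⇒m<n∨m≡n k≤r)
        where
        open ReturnPath s step ret
        bound : ∀ {i t} → i + suc t ≡ 3 + k → i < 3 + r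
        bound {i} {t} e = ≤-trans (m≤m+n (suc i) t)
          (≤-trans (≤-reflexive (trans (sym (+-suc i t)) e)) (s≤s (s≤s (s≤s k≤r))))
        chain : ∀ i t → suc i + suc t ≡ 3 + k → W (replicate (suc t) (2 + k)) (s (suc i)) (s 0)
        chain zero    .(1 + k) refl = W-transport (replicate (2 + k) (2 + k)) (op a₀) (op (step 0 (s≤s z≤n))) w₀
        chain (suc i) t e =
          let e′ = trans (+-suc (suc i) (suc t)) e
              u , a , v , b , w = chain i (suc t) e′
          in v , same-succ a (step (suc i) (bound {suc i} {suc t} e′)) b , w
        last : Arc (2 + k) (s (2 + k)) (s 0)
        last = let v , a , e = chain (1 + k) 0 (+-comm (2 + k) 1) in subst (Arc (2 + k) (s (2 + k))) e a
        last′ : Arc (2 + k) (s (2 + k)) (s (3 + k))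
        last′ = step (2 + k) (s≤s (s≤s (s≤s k≤r)))
        sym-ret : rel (s 0) (s (3 + r)) ≢ rel (s (3 + r)) (s 0)
        sym-ret e = case trans (sym (fwd ret)) (trans (cong proj₁ e) (bwd ret)) of λ ()
        longer : k < r → ⊥
        longer k<r with m≤n⇒∃[o]m+o≡n k<r
        ... | o , e = case trans (sym (fwd (same-succ last′ last (step (3 + k) (s≤s (s≤s (s≤s k<r)))))))
                             (geo₀ (4 + k) o (trans (+-comm o (4 + k)) (cong (3 +_) e))) of λ ()

  turn? : ∀ k → Dec (∃ λ x → ∃ λ y → ∃ λ z → Arc (2 + k) x y × Arc (2 + k) y z × rel x z ≢ (2 , 1 + k))
  turn? k = any? λ x → any? λ y → any? λ z →
    (rel x y ≟ᴿ (1 , 2 + k)) ×-dec (rel y z ≟ᴿ (1 , 2 + k)) ×-dec ¬? (rel x z ≟ᴿ (2 , 1 + k))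

  -- Two different continuations show that `(1 , 2 + k)` is not thin, hence neither is `g`; so the
  -- relation of the turn is thin and `Lattice` applies.
  pure-turn : ∀ {r k x y} → 3 + k ≤ r → Cl (replicate (3 + k) (2 + k)) →
              (∃ λ x → ∃ λ y → ∃ λ z → Arc (2 + k) x y × Arc (2 + k) y z × rel x z ≢ (2 , 1 + k)) →
              ∀ t → W (replicate t (2 + k)) x y → rel x y ≢ (r , 1)
  pure-turn {k = k} le cl (a , b , c , ab , bc , ac≢g) t w xy =
    walk-end-order t w xy le
    where
    g∈ : (2 , 1 + k) ∈² (1 , 2 + k)
    g∈ = let (x , y , xy , z , yz , w) = cl in x , y , z , xy , yz , pure-square xy yz w
    R∈ : rel a c ∈² (1 , 2 + k)
    R∈ = a , b , c , ab , bc , refl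
    g-not-thin : ¬ Thin (2 , 1 + k)
    g-not-thin t = let z , bz , az = next² g∈ ab
                   in ac≢g (subst (λ v → rel a v ≡ (2 , 1 + k)) (pure-square-thin cl t bz bc) az)

    opaque
      thin : Thin (rel a c)
      thin = thin-first g-not-thin (square-thin ac≢g R∈ g∈)

    open Lattice cl thin R∈ ac≢g

  no-power-walk : ∀ {r e x y} → (∀ m → m < 3 + r → 1 ≤ m → Good m) → 1 ≤ e → e < 3 + r →
                  W (replicate (3 + r) e) x y → rel x y ≢ (3 + r , 1)
  no-power-walk {r} {suc zero} good 1≤e e< w xy with vertices (3 + r) w
  ... | s , refl , refl , step = type-one s step xy
  no-power-walk {r} {suc (suc k)} good 1≤e e< w xy with vertices (3 + r) w
  ... | s , refl , refl , step = by-circuit (good (2 + k) e< 1≤e _ (proj₁ (proj₂ circ)) (s 0 , s 1 , a , proj₂ (proj₂ circ)))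
                                            (proj₁ (proj₂ circ)) (proj₂ (proj₂ circ))
    where
    a : Arc (2 + k) (s 0) (s 1)
    a = step 0 (s≤s z≤n)
    k≤r : k ≤ r
    k≤r = s≤s⁻¹ (s≤s⁻¹ (s≤s⁻¹ e<))
    circ : ∃ λ M → length M ≡ 2 + k × W M (s 1) (s 0)
    circ = circuit-at a
    by-turn : Cl (replicate (3 + k) (2 + k)) → Dec _ → ⊥
    by-turn cl (yes t) = pure-turn e< cl t (3 + r) w xy
    by-turn cl (no ¬t) = type-pure s {k}
      (λ {x} {y} {z} p q → decidable-stable (rel x z ≟ᴿ (2 , 1 + k)) (λ ≢g → ¬t (x , y , z , p , q , ≢g))) k≤r cl step xy
    by-circuit : ∀ {M} → Circuit (2 + k) M → length M ≡ 2 + k → W M (s 1) (s 0) → ⊥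
    by-circuit (pure p) len v =
      by-turn (s 0 , s 1 , a , subst (λ l → W l (s 1) (s 0)) (replicate-all p len) v) (turn? k)
    by-circuit (mixed _ sq) _ _ =
      type-mixed s k≤r (Sq-pure k (good (1 + k) (<-trans (n<1+n _) e<) (s≤s z≤n)) sq) sq step xy

-- The induction for the description of circuits

module GoodTypes (S : Scheme) where
  open NoPowerWalk S public

  dist-loop : ∀ {k x y} → dist x y ≡ suc k → x ≢ y
  dist-loop {x = x} p refl = 0≢1+n (trans (sym (dist-refl x)) p)

  arc-≥1 : ∀ {e x y} → Arc e x y → 1 ≤ e
  arc-≥1 {zero}  a = ⊥-elim (dist-loop (fwd a) (sym (dist-zero (bwd a))))
  arc-≥1 {suc e} a = s≤s z≤n

  dist-1or2 : ∀ {e f x y z} → Arc e x y → Arc f y z → x ≢ z → dist x z ≢ 1 → dist x z ≡ 2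
  dist-1or2 {x = x} {z = z} a b x≢z ≢1 = go (dist x z) refl (dist≤2 a b)
    where
    go : ∀ k → dist x z ≡ k → dist x z ≤ 2 → dist x z ≡ 2
    go 0 e _ = ⊥-elim (x≢z (dist-zero e))
    go 1 e _ = ⊥-elim (≢1 e)
    go 2 e _ = e
    go (suc (suc (suc k))) e le = contradiction (subst (_≤ 2) e le) λ { (s≤s (s≤s ())) }

  partition : ∀ (a : ℕ) l → ∃ λ u → ∃ λ l′ → l ↭ replicate u a ++ l′ × All (_≢ a) l′
  partition a [] = 0 , [] , ↭.refl , []
  partition a (b ∷ l) with partition a l | b ≟ a
  ... | u , l′ , p , n | yes refl = suc u , l′ , prep b p , n
  ... | u , l′ , p , n | no b≢a = u , b ∷ l′ , ↭.trans (prep b p) (↭-sym (shift b (replicate u a) l′)) , b≢a ∷ n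

  module Step {m : ℕ} (good : ∀ k → k < 3 + m → 1 ≤ k → Good k) where

    private
      A c c₂ : ℕ
      A = 3 + m
      c = 2 + m
      c₂ = 1 + m
      d : ℕ × ℕ
      d = 2 , 2 + m

    good-c : Good c
    good-c = good c ≤-refl (s≤s z≤n)

    -- For v with (v , x) of type c and (v , y) of type c₂, the pair (v , w) is symmetric,
    -- which forces m = 0.
    mixed-triangle : ∀ {x w y} → Sq c c₂ → Cl (c ∷ c ∷ replicate c₂ c₂) →
                     Arc A x w → Arc c₂ w y → Arc c x y → ⊥
    mixed-triangle {x} {w} {y} sq cl xw wy xy with prev² sq xy
    ... | v , vx , vy = by-m m refl
      where
      vw-sym : dist v w ≡ dist w v
      vw-sym = dist-symIn vy wy
      vw≤2 : dist v w ≤ 2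
      vw≤2 = dist≤2 vx xw
      wv≥ : 2 + m ≤ dist w v
      wv≥ = s≤s⁻¹ (back≥′ (fwd vx) xw)
      by-m : ∀ k → m ≡ k → ⊥
      by-m (suc k) e = <⇒≱ (s≤s (s≤s (s≤s z≤n))) (≤-trans (subst (λ k → 2 + k ≤ dist w v) e wv≥) (≤-trans (≤-reflexive (sym vw-sym)) vw≤2))
      by-m zero refl = impure (square-pure good-c (proj₁ pair) (2 ∷ 1 ∷ []) refl cl)
        where
        vw : rel v w ≡ (2 , 2)
        vw = let e = ≤-antisym vw≤2 (≤-trans wv≥ (≤-reflexive (sym vw-sym)))
             in cong₂ _,_ e (trans (sym vw-sym) e)
        cl₁ : Cl (2 ∷ 3 ∷ 1 ∷ 1 ∷ [])
        cl₁ = let (a , b , ab , rest) = cl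
                  w′ , aw′ , w′b = mid xy ab xw wy
              in Cl-perm {l = 3 ∷ 1 ∷ 2 ∷ 1 ∷ []} (↭.trans (prep 3 (swap 1 2 ↭.refl)) (swap 3 2 ↭.refl))
                   (a , w′ , aw′ , b , w′b , rest)
        cl₂ : Cl (1 ∷ 1 ∷ 3 ∷ 2 ∷ [])
        cl₂ = Cl-perm (↭.trans (++-comm (2 ∷ 3 ∷ []) (1 ∷ 1 ∷ [])) (prep 1 (prep 1 (swap 2 3 ↭.refl)))) cl₁
        cl₃ : Cl (3 ∷ 3 ∷ 2 ∷ 2 ∷ [])
        cl₃ = let (a , b , ab , e , be , rest) = cl₂
                  ae = fwd-exact {3} refl (here refl) ab be rest
                  b′ , ab′ , b′e = mid vw (cong₂ _,_ ae (trans (sym (dist-symIn ab (op be))) ae)) vx xw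
              in Cl-perm {l = 2 ∷ 3 ∷ 3 ∷ 2 ∷ []} (↭.trans (swap 2 3 ↭.refl) (prep 3 (swap 2 3 ↭.refl)))
                   (a , b′ , ab′ , e , b′e , rest)
        pair : Sq 3 2 × All (_≡ 2) (2 ∷ 2 ∷ [])
        pair = two-of-type good-c refl ((λ ()) ∷ (λ ()) ∷ []) cl₃
        impure : ¬ All (_≡ 2) (2 ∷ 1 ∷ [])
        impure (_ ∷ () ∷ _)

    on-circuit : ∀ {x y z E N} → length N ≡ c → E ∈ N → Cl (c ∷ N) → E ≢ c →
                 Arc A x y → Arc E y z → Arc c x z → ⊥
    on-circuit {E = E} {N} len E∈ cl E≢c xy yz xz = by-circuit (good-c _ len cl)
      where
      by-circuit : Circuit c N → ⊥
      by-circuit (pure a) = E≢c (All.lookup a E∈)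
      by-circuit (mixed p sq) = mixed-triangle sq (Cl-perm (prep c p) cl) xy
          (subst (λ e → Arc e _ _) (only (∈-resp-↭ p E∈)) yz) xz
        where
        only : E ∈ c ∷ replicate c₂ c₂ → E ≡ c₂
        only (here e) = ⊥-elim (E≢c e)
        only (there i) = All.lookup {P = _≡ c₂} (replicate⁺ c₂ refl) i

    leading-c : ∀ {M} → Circuit c M → length M ≡ c → ∃ λ M′ → M ↭ c ∷ M′
    leading-c {_ ∷ M} (pure (refl ∷ _)) len = M , ↭.refl
    leading-c (mixed p _) len = _ , p

    -- Replaces `exact` where no further arc of type `A` is at hand: a chord `(x , z)` would have
    -- type `c` like `(y , z)`, which makes `x` and `y` symmetric.
    Ac-exact : ∀ {x y z L} → length L ≡ 2 + m → Arc A x y → Arc c y z → W L z x → rel x z ≡ d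
    Ac-exact {x} {y} {z} len xy yz w = cong₂ _,_ (dist-1or2 xy yz x≢z ≢1) zx
      where
      zx : dist z x ≡ 2 + m
      zx = trans (back-exact (cong suc len) xy yz w) len
      x≢z : x ≢ z
      x≢z = dist-loop zx ∘ sym
      ≢1 : dist x z ≢ 1
      ≢1 p = contradiction (trans (sym (fwd xy)) (trans (dist-symIn {R = 1 , c} (cong₂ _,_ p zx) yz) (bwd xy))) λ ()

    module Triangle {x y z E} (E≢c : E ≢ c) (E≢A : E ≢ A)
                    (xy : Arc A x y) (yz : Arc E y z) (xz : Arc c x z) where

      -- A shorter return would put `E` on a closed walk of `c + 1` arcs through type `c`, which
      -- `on-circuit` excludes because of the triangle.
      Ec-exact : ∀ {a b e M} → length M ≡ 1 + m → Arc E a b → Arc c b e → W (A ∷ M) e a → rel a e ≡ d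
      Ec-exact {a} {b} {e} {M} len ab be w =
        cong₂ _,_ (fwd-exact {A} (cong (2 +_) len) (here refl) ab be w) (≤-antisym le (≮⇒≥ short))
        where
        le : dist e a ≤ 2 + m
        le = ≤-trans (W-length (A ∷ M) w) (≤-reflexive (cong suc len))
        short : ¬ dist e a < 2 + m
        short lt with geodesic (dist e a) {e} {a} refl
        ... | N , lenN , v = on-circuit {N = E ∷ N} (≤-antisym (subst (_≤ 2 + m) (sym (cong suc lenN)) lt) (Cl-length cl))
                               (here refl) cl E≢c xy yz xz
          where
          cl : Cl (c ∷ E ∷ N)
          cl = Cl-perm (swap E c ↭.refl) (a , b , ab , e , be , v)

      two-A : ∀ {M} → length M ≡ 1 + m → All (_≢ A) M → W (c ∷ M) z x → Sq A c × All (_≡ c) (c ∷ M)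
      two-A {M} len M≢ w = two-of-type good-c (cong suc len) ((λ e → 1+n≢n (sym e)) ∷ M≢)
          (Cl-perm {l = A ∷ c ∷ A ∷ M} (prep A (swap c A ↭.refl)) replaced)
        where
        Ac : Cl (A ∷ c ∷ E ∷ M)
        Ac = Cl-perm (prep A (swap E c ↭.refl)) (x , y , xy , z , yz , w)
        Ec : Cl (E ∷ c ∷ A ∷ M)
        Ec = Cl-perm (↭.trans (swap A E ↭.refl) (prep E (swap A c ↭.refl))) (x , y , xy , z , yz , w)
        replaced : Cl (A ∷ c ∷ A ∷ M)
        replaced =
          let a , b , ab , e , be , v = Ac
              a′ , b′ , ab′ , e′ , be′ , v′ = Ec
              b″ , ab″ , be″ = mid (Ac-exact (cong suc len) ab be v) (Ec-exact len ab′ be′ v′) ab be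
          in a′ , b″ , ab″ , e′ , be″ , v′

      -- Both z and v below are c-out-neighbours of x and have the same c-out-neighbours u, u′,
      -- so (v , z) is a thin involution ε and arcs of type E arise from arcs of type A by ε.
      module Shared {u v u′} (yv : Arc A y v) (xv : Arc c x v) (u≢u′ : u ≢ u′)
                    (zu : Arc c z u) (vu : Arc c v u) (zu′ : Arc c z u′) (vu′ : Arc c v u′) where

        z≢v : z ≢ v
        z≢v = ≢-rel yz yv (arc≢ E≢A)

        ε : ℕ × ℕ
        ε = rel z v

        ε-op : rel v z ≡ ε
        ε-op = symIn vu zu

        ε-thin : Thin ε
        ε-thin = thin-at {z} {v} only
          where
          in-nbr : ∀ {w t} → Arc c w t → t ≡ u ⊎ t ≡ u′ → w ≡ z ⊎ w ≡ v
          in-nbr wt (inj₁ refl) = third′ z≢v zu vu wt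
          in-nbr wt (inj₂ refl) = third′ z≢v zu′ vu′ wt
          only : ∀ {w} → rel z w ≡ ε → w ≡ v
          only {w} zw with mid {P = 1 , c} refl zw zu (op vu)
          ... | t , zt , tw with in-nbr (op tw) (third u≢u′ zu zu′ zt)
          ...   | inj₂ e = e
          ...   | inj₁ refl = ⊥-elim (z≢v (dist-zero (trans (sym (cong proj₁ zw)) (dist-refl z))))

        -- `(y , v)` splits into `E` and `ε`, hence so does `(x , y)`; commuting `ε` past `(y , z)`
        -- makes the second arc of type `E` end at `v`.
        sq : Sq E c
        sq with mid yv xy yz refl
        ... | w , xw , wy with comm wy yz
        ...   | t , wt , tz with thinᵒ ε-thin tz ε-op
        ...     | refl = x , w , v , xw , wt , xv

    no-arc-square : ∀ {E} → 1 ≤ E → E < A → ¬ Sq E c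
    no-arc-square {suc zero}    _ E< sq = contradiction (Sq-one sq) λ ()
    no-arc-square {suc (suc k)} _ E< sq = <⇒≢ E< (cong suc (sym (sq-type A good k c E< ≤-refl sq)))

    type< : ∀ {E L} → length L ≡ 3 + m → E ∈ L → E ≢ A → Cl (A ∷ L) → E < A
    type< {E} len E∈ E≢A cl = ≤∧≢⇒< (s≤s⁻¹ (subst (E <_) (cong suc len) (Cl-length∈ (there E∈) cl))) E≢A

    two-mids : ∀ {x u u′ z v g} → rel x u ≡ g → rel x u′ ≡ g → z ≢ v → Arc c x z → Arc c z u →
               Arc c x v → Arc c v u → Arc c z u′ × Arc c v u′
    two-mids {u′ = u′} {z} {v} xu xu′ z≢v xz zu xv vu with mid₂ xu xu′ z≢v xz zu xv vu
    ... | p , q , p≢q , (xp , pu) , (xq , qu) with third p≢q xp xq xz | third p≢q xp xq xv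
    ...   | inj₁ refl | inj₁ refl = ⊥-elim (z≢v refl)
    ...   | inj₁ refl | inj₂ refl = pu , qu
    ...   | inj₂ refl | inj₁ refl = qu , pu
    ...   | inj₂ refl | inj₂ refl = ⊥-elim (z≢v refl)

    second-g : ∀ {x u z v} → z ≢ v → Arc c x z → Arc c x v → Cl (replicate (3 + m) c) → rel x u ≡ (2 , 1 + m) →
               ∃ λ u′ → u′ ≢ u × rel x u′ ≡ (2 , 1 + m)
    second-g {x} {u} z≢v xz xv cl xu with any? (λ u′ → ¬? (u′ Fin.≟ u) ×-dec (rel x u′ ≟ᴿ (2 , 1 + m)))
    ... | yes p = p
    ... | no ¬p = ⊥-elim (z≢v (pure-square-thin cl (thin-at {x} {u} unique) xz xv))
      where
      unique : ∀ {w} → rel x w ≡ (2 , 1 + m) → w ≡ u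
      unique {w} xw with w Fin.≟ u
      ... | yes e = e
      ... | no w≢u = ⊥-elim (¬p (w , w≢u , xw))

    -- Given the chord, `two-A` makes the rest of the walk consist of arcs of type `c`, and an
    -- exchange across `(y , u)` gives a second `c`-successor `v` of `x`. As `z` and `v` share two
    -- successors, `Shared` puts `c` into the square of `E`, which is impossible for `E < A`.
    no-shortcut : ∀ {x y z E M} → length M ≡ 2 + m → All (_≢ A) (E ∷ M) →
                  Arc A x y → Arc E y z → W M z x → ¬ Arc c x z
    no-shortcut {x} {y} {z} {E} {M} len (E≢A ∷ M≢A) xy yz w xz = by-type (E ≟ c)
      where
      E< : E < A
      E< = type< (cong suc len) (here refl) E≢A (x , y , xy , z , yz , w)
      by-type : Dec (E ≡ c) → ⊥
      by-type (yes refl) = contradiction (trans (sym (fwd xy)) (trans (dist-symIn xz yz) (bwd xy))) λ ()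
      by-type (no E≢c) = main (leading-c (good-c M len (x , z , xz , w)) len)
        where
        open Triangle E≢c E≢A xy yz xz
        main : (∃ λ M′ → M ↭ c ∷ M′) → ⊥
        main (M′ , p) = at (W-perm p w)
          where
          len′ : length M′ ≡ 1 + m
          len′ = suc-injective (trans (sym (↭-length p)) len)
          M′≢A : All (_≢ A) M′
          M′≢A = All.tail (All-resp-↭ p M≢A)
          at : W (c ∷ M′) z x → ⊥
          at wz@(u , zu , wu) = finish (let (a , b , ab , e , be , w′) = Ac
                                        in mid (Ac-exact (cong suc len′) ab be w′) (Ec-exact len′ yz zu yu-rest) ab be)
            where
            Ac : Cl (A ∷ c ∷ E ∷ M′)
            Ac = Cl-perm (prep A (swap E c ↭.refl)) (x , y , xy , z , yz , wz)
            yu-rest : W (A ∷ M′) u y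
            yu-rest = W-perm (++-comm M′ (A ∷ [])) (W-++ M′ wu (y , xy , refl))
            M′≡ : M′ ≡ replicate (1 + m) c
            M′≡ = replicate-all (All.tail (proj₂ (two-A len′ M′≢A wz))) len′
            wu′ : W (replicate (1 + m) c) u x
            wu′ = subst (λ L → W L u x) M′≡ wu
            xu : rel x u ≡ (2 , 1 + m)
            xu = pure-square xz zu wu′
            finish : (∃ λ v → Arc A y v × Arc c v u) → ⊥
            finish (v , yv , vu) = third-u (second-g z≢v xz xv (x , z , xz , u , zu , wu′) xu)
              where
              xv : Arc c x v
              xv = square-arc len′ ((λ e → 1+n≢n (sym e)) ∷ M′≢A) xy yv (u , vu , wu)
              z≢v : z ≢ v
              z≢v = ≢-rel yz yv (arc≢ E≢A)
              third-u : (∃ λ u′ → u′ ≢ u × rel x u′ ≡ (2 , 1 + m)) → ⊥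
              third-u (u′ , u′≢u , xu′) =
                let zu′ , vu′ = two-mids xu xu′ z≢v xz zu xv vu
                in no-arc-square (arc-≥1 yz) E< (Shared.sq yv xv (u′≢u ∘ sym) zu vu zu′ vu′)

    spread : ∀ {x y z E M} → length M ≡ 2 + m → All (_≢ A) (E ∷ M) →
             Arc A x y → Arc E y z → W M z x → rel x z ≡ d
    spread {x} {y} {z} {E} {M} len ≢A xy yz w = cong₂ _,_ (dist-1or2 xy yz x≢z ≢1) zx
      where
      zx : dist z x ≡ 2 + m
      zx = trans (back-exact (cong suc len) xy yz w) len
      x≢z : x ≢ z
      x≢z = dist-loop zx ∘ sym
      ≢1 : dist x z ≢ 1
      ≢1 p = no-shortcut len ≢A xy yz w (cong₂ _,_ p zx)

    -- With chords excluded, `A` `E` and `A` `F` span the same relation `d`, so each `F` can be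
    -- turned into `E`.
    to-power : ∀ k M {E} → suc k + length M ≡ 3 + m → E ≢ A → All (_≢ A) M →
               Cl (A ∷ replicate (suc k) E ++ M) → Cl (A ∷ replicate (suc k + length M) E)
    to-power k [] {E} len E≢A _ cl =
      subst (λ L → Cl (A ∷ L)) (trans (++-identityʳ (replicate (suc k) E)) (cong (λ t → replicate t E) (sym (+-identityʳ (suc k))))) cl
    to-power k (F ∷ M) {E} len E≢A (F≢A ∷ M≢A) cl =
      subst (λ t → Cl (A ∷ replicate t E)) (sym (+-suc (suc k) (length M)))
        (to-power (suc k) M (trans (sym (+-suc (suc k) (length M))) len) E≢A M≢A exchanged)
      where
      moved : Cl (A ∷ F ∷ replicate (suc k) E ++ M)
      moved = Cl-perm (prep A (shift F (replicate (suc k) E) M)) cl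
      len₁ : ∀ t L → length (replicate t E ++ L) ≡ t + length L
      len₁ t L = trans (length-++ (replicate t E)) (cong (_+ length L) (length-replicate t))
      ≢₁ : ∀ t {L} → All (_≢ A) L → All (_≢ A) (replicate t E ++ L)
      ≢₁ t a = ++⁺ (replicate⁺ t E≢A) a
      exchanged : Cl (A ∷ replicate (2 + k) E ++ M)
      exchanged =
        let a , b , ab , e , be , w = cl
            a′ , b′ , ab′ , e′ , be′ , w′ = moved
            b″ , ab″ , be″ = mid (spread (trans (len₁ k (F ∷ M)) (suc-injective len)) (E≢A ∷ ≢₁ k (F≢A ∷ M≢A)) ab be w)
                                 (spread (trans (len₁ (suc k) M) (trans (sym (+-suc k (length M))) (suc-injective len)))
                                         (F≢A ∷ ≢₁ (suc k) M≢A) ab′ be′ w′) ab be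
        in a′ , b″ , ab″ , e′ , be″ , w′

    no-single : ∀ {M} → length M ≡ 3 + m → All (_≢ A) M → ¬ Cl (A ∷ M)
    no-single {E ∷ M} len (E≢A ∷ M≢A) cl = power (to-power 0 M len E≢A M≢A cl) cl
      where
      power : Cl (A ∷ replicate (1 + length M) E) → Cl (A ∷ E ∷ M) → ⊥
      power (x , y , xy , w) (_ , _ , _ , _ , yz , _) =
        no-power-walk good (arc-≥1 yz) (type< len (here refl) E≢A cl)
          (subst (λ t → W (replicate t E) y x) len w) (op xy)

    good-next : Good A
    good-next M len cl with partition A M
    ... | zero , M₂ , p , ≢A = ⊥-elim (no-single (trans (sym (↭-length p)) len) ≢A (Cl-perm (prep A p) cl))
    ... | suc zero , M₂ , p , ≢A
      with two-of-type good-c (suc-injective (trans (sym (↭-length p)) len)) ≢A (Cl-perm (prep A p) cl)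
    ...   | sq , all = mixed (subst (λ L → M ↭ A ∷ L)
                          (replicate-all all (suc-injective (trans (sym (↭-length p)) len))) p) sq
    good-next M len cl | suc (suc u) , [] , p , _ =
      pure (All-resp-↭ (↭-sym p) (++⁺ (replicate⁺ (suc (suc u)) refl) []))
    good-next M len cl | suc (suc u) , E ∷ M₂ , p , E≢A ∷ _ =
      ⊥-elim (no-three (suc-injective (suc-injective (suc-injective (trans (sym (↭-length q)) len)))) E≢A (Cl-perm (prep A q) cl))
      where
      q : M ↭ A ∷ A ∷ E ∷ (replicate u A ++ M₂)
      q = ↭.trans p (prep A (prep A (shift E (replicate u A) M₂)))

  good-two : Good 2
  good-two (E ∷ F ∷ []) len cl = by-types (E ≟ 2) (F ≟ 2)
    where
    one : ∀ {G L} → G ∈ L → length L ≡ 3 → Cl L → G ≢ 2 → (∃ λ x → ∃ λ y → Arc G x y) → G ≡ 1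
    one {suc zero} _ _ _ _ _ = refl
    one {zero} _ _ _ _ (x , y , a) = contradiction (arc-≥1 a) λ ()
    one {suc (suc zero)} _ _ _ ≢2 _ = ⊥-elim (≢2 refl)
    one {suc (suc (suc G))} G∈ len cl _ _ = contradiction (subst (3 + G <_) len (Cl-length∈ G∈ cl)) λ { (s≤s (s≤s (s≤s ()))) }
    mixed₁ : ∀ {G} → Cl (2 ∷ 2 ∷ G ∷ []) → G ≢ 2 → G ≡ 1 × Sq 2 1
    mixed₁ cl′@(x , y , xy , z , yz , .x , zx , refl) G≢2 with one (there (there (here refl))) refl cl′ G≢2 (z , x , zx)
    ... | refl = refl , x , y , z , xy , yz , op zx
    none : ∀ {G H} → G ≡ 1 → H ≡ 1 → ¬ Cl (2 ∷ G ∷ H ∷ [])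
    none refl refl (x , y , xy , z , yz , .x , zx , refl) =
      contradiction (trans (sym (fwd xy)) (trans (dist-symIn (op zx) yz) (bwd xy))) λ ()
    by-types : Dec (E ≡ 2) → Dec (F ≡ 2) → Circuit 2 (E ∷ F ∷ [])
    by-types (yes refl) (yes refl) = pure (refl ∷ refl ∷ [])
    by-types (yes refl) (no F≢2) with mixed₁ cl F≢2
    ... | refl , sq = mixed ↭.refl sq
    by-types (no E≢2) (yes refl) with mixed₁ (Cl-perm (prep 2 (swap E 2 ↭.refl)) cl) E≢2
    ... | refl , sq = mixed (swap 1 2 ↭.refl) sq
    by-types (no E≢2) (no F≢2) = ⊥-elim (both cl)
      where
      both : ¬ Cl (2 ∷ E ∷ F ∷ [])
      both (x , y , xy , z , yz , x′ , zx , _) =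
        none (one (there (here refl)) refl cl E≢2 (y , z , yz)) (one (there (there (here refl))) refl cl F≢2 (z , x′ , zx)) cl

  goods : ∀ B k → k < B → 1 ≤ k → Good k
  goods (suc B) (suc zero)          k< _ = good-one
  goods (suc B) (suc (suc zero))    k< _ = good-two
  goods (suc B) (suc (suc (suc m))) k< _ = Step.good-next (λ k lt → goods B k (<-≤-trans lt (s≤s⁻¹ k<)))

  good-all : ∀ {k} → 1 ≤ k → Good k
  good-all {k} = goods (suc k) k ≤-refl

  square-type : ∀ {k s} → Sq (2 + k) s → s ≡ 1 + k
  square-type {k} {s} = sq-type (suc ((2 + k) ⊔ s)) (λ n lt → goods _ n lt) k s
    (s≤s (m≤m⊔n (2 + k) s)) (s≤s (m≤n⊔m (2 + k) s))

  square-pureᶜ : ∀ {k} → Sq (2 + k) (1 + k) → Pureᶜ (1 + k)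
  square-pureᶜ {k} = Sq-pure k (good-all (s≤s z≤n))

-- Products of two different arc types

module ArcProducts (S : Scheme) where
  open GoodTypes S public

  both-succ : ∀ {y a b u v E} → u ≢ v → rel y u ≡ E → rel y v ≡ E →
              a ≢ b → (∀ {w} → rel y w ≡ E → w ≡ a ⊎ w ≡ b) → rel y a ≡ E × rel y b ≡ E
  both-succ u≢v yu yv a≢b h with h yu | h yv
  ... | inj₁ refl | inj₁ refl = ⊥-elim (u≢v refl)
  ... | inj₁ refl | inj₂ refl = yu , yv
  ... | inj₂ refl | inj₁ refl = yv , yu
  ... | inj₂ refl | inj₂ refl = ⊥-elim (u≢v refl)

  share-succ : ∀ {x y y′ a b A E R} → rel x y ≡ A → rel x y′ ≡ A → a ≢ b → rel y a ≡ E → rel y b ≡ E →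
               rel x a ≡ R → rel x b ≡ R → rel y′ a ≡ E × rel y′ b ≡ E
  share-succ {y′ = y′} xy xy′ a≢b ya yb xa xb with distinct {y = y′} a≢b ya yb
  ... | u , v , u≢v , yu , yv = both-succ u≢v yu yv a≢b
          (λ y′w → third a≢b xa xb (allSucc xy a≢b ya yb xa xb xy′ y′w))

  module ThreeTypes {m s t : ℕ} (1≤s : 1 ≤ s) (s<t : s < t) (t<r : t < 3 + m)
                    {p w q : Vertex} (pw : Arc s p w) (wq : Arc t w q) (pq : Arc (3 + m) p q) where

    private
      r c : ℕ
      r = 3 + m
      c = 2 + m
      d D : ℕ × ℕ
      d = 2 , 2 + m
      D = 2 , 3 + m

    c≢r : c ≢ r
    c≢r e = 1+n≢n (sym e)

    s<c : s < c
    s<c = <-≤-trans s<t (s≤s⁻¹ t<r)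

    s≢r : s ≢ r
    s≢r = <⇒≢ (<-trans s<t t<r)

    t≢r : t ≢ r
    t≢r = <⇒≢ t<r

    s≢t : s ≢ t
    s≢t = <⇒≢ s<t

    t≢1 : t ≢ 1
    t≢1 e = <⇒≢ (≤-<-trans 1≤s s<t) (sym e)

    good : Good r
    good = good-all (s≤s z≤n)

    opaque
      st : ∀ {x y} → Arc r x y → ∃ λ z → Arc s x z × Arc t z y
      st xy = mid pq xy pw wq

    opaque
      ts : ∀ {x y} → Arc r x y → ∃ λ z → Arc t x z × Arc s z y
      ts xy = let z , a , b = st xy in comm a b

    opaque
      no-s : ∀ {N} → length N ≡ 2 + m → ¬ Cl (r ∷ s ∷ N)
      no-s {N} len cl = go (circuit-types (good (s ∷ N) (cong suc len) cl))
        where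
        go : All (λ k → k ≡ r ⊎ suc k ≡ r) (s ∷ N) → ⊥
        go (inj₁ e ∷ _) = s≢r e
        go (inj₂ e ∷ _) = <⇒≢ s<c (suc-injective e)

    opaque
      ¬Sq-s : ¬ Sq s r
      ¬Sq-s = go s 1≤s refl
        where
        go : ∀ k → 1 ≤ k → s ≡ k → ¬ Sq s r
        go (suc zero)    _ refl sq = contradiction (Sq-one sq) λ ()
        go (suc (suc k)) _ refl sq = <⇒≱ (<-trans s<t t<r) (≤-trans (≤-reflexive (square-type sq)) (n≤1+n _))

    opaque
      ¬Sq-t : ¬ Sq t c
      ¬Sq-t = go t (≤-trans (s≤s 1≤s) s<t) refl
        where
        go : ∀ k → 2 ≤ k → t ≡ k → ¬ Sq t c
        go (suc (suc k)) _ refl sq = t≢r (cong suc (sym (square-type sq)))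
        go (suc zero) (s≤s ()) _

    opaque
      -- Otherwise `x` and `z`, the tails of two arcs of type `c` into `q`, are symmetric; being at
      -- most 2 apart both ways, they put `s` on a circuit of type `r`.
      t≢c : Sq r c → t ≢ c
      t≢c sq refl with st pq
      ... | z , pz , zq with prev² sq pq
      ...   | x , xp , xq with geodesic (dist z x) {z} {x} refl
      ...     | N , len , v = no-s (trans len (≤-antisym zx≤ (s≤s⁻¹ (back≥ xp (fwd pz))))) (x , p , xp , z , pz , v)
        where
        zx≤ : dist z x ≤ 2 + m
        zx≤ = ≤-trans (≤-reflexive (sym (dist-symIn xq zq))) (≤-trans (dist≤2 xp pz) (s≤s (s≤s z≤n)))

    opaque
      no-t : ∀ {N} → length N ≡ 2 + m → ¬ Cl (r ∷ t ∷ N)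
      no-t {N} len cl = go (good (t ∷ N) (cong suc len) cl) (λ sq → t≢c sq)
        where
        go : Circuit r (t ∷ N) → (Sq r c → t ≢ c) → ⊥
        go (pure (e ∷ _)) _ = t≢r e
        go cc@(mixed _ sq) ≢c with circuit-types cc
        ... | inj₁ e ∷ _ = t≢r e
        ... | inj₂ e ∷ _ = ≢c sq (suc-injective e)

    opaque
      -- Types kept off the circuits of `r + 1` arcs through type `r` miss the least return distance
      -- `2 + m` by at least one; hence the constant in `D`.
      back-large : ∀ {e} → (∀ {N} → length N ≡ 2 + m → ¬ Cl (r ∷ e ∷ N)) → ∀ {x z} →
                   2 + m ≤ dist z x → (∀ {N} → W N z x → Cl (r ∷ e ∷ N)) → 3 + m ≤ dist z x
      back-large none {x} {z} ge cl = ≤∧≢⇒< ge λ e →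
        let N , len , v = geodesic (dist z x) {z} {x} refl in none (trans len (sym e)) (cl v)

    opaque
      toD : ∀ {e f x y z} → Arc e x y → Arc f y z → 3 + m ≤ dist z x → dist z x ≤ 3 + m → ¬ Arc r x z → rel x z ≡ D
      toD {x = x} {z = z} xy yz ge le ≢r = cong₂ _,_ (dist-1or2 xy yz x≢z (λ e → ≢r (cong₂ _,_ e zx))) zx
        where
        zx : dist z x ≡ 3 + m
        zx = ≤-antisym le ge
        x≢z : x ≢ z
        x≢z = dist-loop zx ∘ sym

    opaque
      rt-D : ∀ {x y z} → Arc r x y → Arc t y z → dist z x ≤ 3 + m → rel x z ≡ D
      rt-D {x} {y} {z} xy yz le = toD xy yz
        (back-large no-t (s≤s⁻¹ (back≥ xy (fwd yz))) (λ v → x , y , xy , z , yz , v)) le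
        (λ xz → t≢1 (trans (sym (bwd yz)) (trans (sym (dist-symOut xy xz)) (fwd yz))))

    opaque
      tr-D : ∀ {x y z} → Arc t x y → Arc r y z → dist z x ≤ 3 + m → rel x z ≡ D
      tr-D {x} {y} {z} xy yz le = toD xy yz
        (back-large no-t (s≤s⁻¹ (back≥′ (fwd xy) yz)) (λ v → Cl-perm (swap t r ↭.refl) (x , y , xy , z , yz , v))) le
        (λ xz → t≢1 (trans (sym (bwd xy)) (trans (sym (dist-symIn xz yz)) (fwd xy))))

    opaque
      sr-D : ∀ {x y z} → Arc s x y → Arc r y z → dist z x ≤ 3 + m → ¬ Arc r x z → rel x z ≡ D
      sr-D {x} {y} {z} xy yz le = toD xy yz
        (back-large no-s (s≤s⁻¹ (back≥′ (fwd xy) yz)) (λ v → Cl-perm (swap s r ↭.refl) (x , y , xy , z , yz , v))) le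

    opaque
      rs-D : ∀ {x y z} → Arc r x y → Arc s y z → dist z x ≤ 3 + m → ¬ Arc r x z → rel x z ≡ D
      rs-D {x} {y} {z} xy yz le = toD xy yz
        (back-large no-s (s≤s⁻¹ (back≥ xy (fwd yz))) (λ v → x , y , xy , z , yz , v)) le

    AllR Mix : Set
    AllR = Cl (replicate (4 + m) r)
    Mix = Sq r c × Cl (r ∷ r ∷ replicate (2 + m) c)

    opaque
      -- Composites `r` `r` of the one kind and `r` `c` of the other span the same relation;
      -- exchanging them puts three arcs of type `r` beside one of type `c`.
      not-both : AllR → Mix → ⊥
      not-both (a , b , ab , e , be , v) (_ , cl) = no-three (length-replicate m) c≢r
          (Cl-perm {l = r ∷ c ∷ r ∷ r ∷ replicate m r} (prep r (↭.trans (swap c r ↭.refl) (prep r (swap c r ↭.refl)))) replaced)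
        where
        rc : Cl (r ∷ c ∷ r ∷ replicate (1 + m) c)
        rc = Cl-perm (prep r (swap r c ↭.refl)) cl
        replaced : Cl (r ∷ c ∷ replicate (2 + m) r)
        replaced =
          let a′ , b′ , ab′ , e′ , be′ , v′ = rc
              d′ = trans (exact (cong (3 +_) (length-replicate m)) (here refl) ab′ be′ v′) (cong (λ k → 2 , suc (suc k)) (length-replicate m))
              b″ , ab″ , be″ = mid d′ (pure-square {1 + m} ab be v) ab′ be′
          in a , b″ , ab″ , e , be″ , v

    opaque
      square-class : ∀ {x y z} → Arc r x y → Arc r y z → dist z x ≡ 2 + m →
                     (AllR × rel x z ≡ d) ⊎ (Mix × Arc c x z)
      square-class {x} {y} {z} xy yz zx with geodesic (2 + m) zx
      ... | N , len , v with good (r ∷ N) (cong suc len) (x , y , xy , z , yz , v)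
      ...   | pure (_ ∷ a) = inj₁ ((x , y , xy , z , yz , v′) , pure-square {1 + m} xy yz v′)
        where
        v′ : W (replicate (2 + m) r) z x
        v′ = subst (λ L → W L z x) (replicate-all a len) v
      ...   | mixed π sq = inj₂ ((sq , x , y , xy , z , yz , v′) ,
              square-arc (length-replicate (1 + m)) (replicate⁺ (2 + m) c≢r) xy yz v′)
        where
        v′ : W (replicate (2 + m) c) z x
        v′ = W-perm (drop-∷ π) v

    opaque
      square-unique : ∀ {x y z x′ y′ z′} → Arc r x y → Arc r y z → dist z x ≡ 2 + m →
                      Arc r x′ y′ → Arc r y′ z′ → dist z′ x′ ≡ 2 + m → rel x z ≡ rel x′ z′
      square-unique xy yz zx xy′ yz′ zx′ with square-class xy yz zx | square-class xy′ yz′ zx′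
      ... | inj₁ (_ , e) | inj₁ (_ , e′) = trans e (sym e′)
      ... | inj₂ (_ , e) | inj₂ (_ , e′) = trans e (sym e′)
      ... | inj₁ (a , _) | inj₂ (b , _) = ⊥-elim (not-both a b)
      ... | inj₂ (b , _) | inj₁ (a , _) = ⊥-elim (not-both a b)

    opaque
      kind : AllR ⊎ Mix
      kind with geodesic r (bwd pq)
      ... | N , len , v with good N len (p , q , pq , v)
      ...   | pure a = inj₁ (p , q , pq , subst (λ L → W L q p) (replicate-all a len) v)
      ...   | mixed π sq = inj₂ (sq , Cl-perm (prep r π) (p , q , pq , v))

    opaque
      on-circuit-pair : ∃ λ x → ∃ λ y → ∃ λ z → Arc r x y × Arc r y z × dist z x ≡ 2 + m
      on-circuit-pair = [ from , (λ { (_ , x , y , xy , z , yz , v) → x , y , z , xy , yz ,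
                          trans (back-exact (cong (3 +_) (length-replicate m)) xy yz v) (cong (2 +_) (length-replicate m)) }) ]′ kind
        where
        from : AllR → ∃ λ x → ∃ λ y → ∃ λ z → Arc r x y × Arc r y z × dist z x ≡ 2 + m
        from (x , y , xy , z , yz , v) = x , y , z , xy , yz ,
          trans (back-exact (cong (3 +_) (length-replicate m)) xy yz v) (cong (2 +_) (length-replicate m))

    opaque
      -- One occurrence suffices: splitting the first arc of a pair on a circuit into `s` and `t`
      -- leaves a composite `t` `r` with relation `D`.
      D-mid-t : ∀ {x z} → rel x z ≡ D → ∃ λ y → Arc t x y × Arc r y z
      D-mid-t xz =
        let a , b , e , ab , be , ea = on-circuit-pair
            k , ak , kb = st ab
        in mid (tr-D kb be (≤-trans (dist-arc′ e ak) (s≤s (≤-reflexive ea)))) xz kb be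

    module CommonTarget {a b z} (ab : Arc s a b) (bz : Arc r b z) (az : Arc r a z) where

      s-sym : ∀ {x y} → Arc s x y → Arc s y x
      s-sym xy = subst (λ k → Arc k _ _) (sym s≡1) (subst (λ k → rel _ _ ≡ (k , 1)) s≡1 (op xy))
        where
        s≡1 : s ≡ 1
        s≡1 = trans (sym (bwd ab)) (trans (sym (dist-symIn az bz)) (fwd ab))

      rs : ∀ {x y} → Arc r x y → ∃ λ v → Arc r x v × Arc s v y
      rs xy = let v , p , q = mid az xy ab bz in comm p q

      common : ∀ {x y} → Arc s x y → ∃ λ v → Arc r x v × Arc r y v
      common xy = right ab xy az bz

      module _ {x₀ x₁ x₂} (x₀x₁ : Arc r x₀ x₁) (x₁x₂ : Arc r x₁ x₂) (x₂x₀ : dist x₂ x₀ ≡ 2 + m)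
               {x₁′ v u} (x₀x₁′ : Arc r x₀ x₁′) (x₁′x₁ : Arc s x₁′ x₁)
               (x₁v : Arc r x₁ v) (vx₂ : Arc s v x₂) (x₀u : Arc t x₀ u) (ux₁ : Arc s u x₁) where

        v≢x₂ : v ≢ x₂
        v≢x₂ = dist-loop (fwd vx₂)

        x₁≢x₁′ : x₁ ≢ x₁′
        x₁≢x₁′ = dist-loop (fwd x₁′x₁) ∘ sym

        u≢x₁′ : u ≢ x₁′
        u≢x₁′ = ≢-rel x₀u x₀x₁′ (arc≢ t≢r)

        u≢x₁ : u ≢ x₁
        u≢x₁ = dist-loop (fwd ux₁)

        vx₀≤ : dist v x₀ ≤ 3 + m
        vx₀≤ = ≤-trans (dist-arc x₀ vx₂) (s≤s (≤-reflexive x₂x₀))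

        vx₀≥ : 2 + m ≤ dist v x₀
        vx₀≥ = s≤s⁻¹ (back≥ x₀x₁ (fwd x₁v))

        -- The common successor of `x₁` and `u` would have the three `r`-predecessors `x₁`, `x₁′`
        -- and `u`.
        both : Arc r x₁′ v → Arc r x₁′ x₂ → ⊥
        both p q with common (s-sym ux₁)
        ... | y , x₁y , uy with third v≢x₂ x₁v x₁x₂ x₁y
        ...   | inj₁ refl = three (x₁≢x₁′) (u≢x₁ ∘ sym) (u≢x₁′ ∘ sym) (op x₁v) (op p) (op uy)
        ...   | inj₂ refl = three (x₁≢x₁′) (u≢x₁ ∘ sym) (u≢x₁′ ∘ sym) (op x₁x₂) (op q) (op uy)

        near : dist v x₀ ≡ 2 + m → ⊥
        near e = let p , q = share-succ x₀x₁ x₀x₁′ v≢x₂ x₁v x₁x₂ refl (sym (square-unique x₀x₁ x₁v e x₀x₁ x₁x₂ x₂x₀))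
                 in both p q

        module Far (x₀v : rel x₀ v ≡ D) where

          D∈ : D ∈² (1 , r)
          D∈ = x₀ , x₁ , v , x₀x₁ , x₁v , x₀v

          ¬x₁′v : ¬ Arc r x₁′ v
          ¬x₁′v x₁′v =
            let y , x₀y , yv = D-mid-t x₀v
            in three x₁≢x₁′ (≢-rel x₀x₁ x₀y (arc≢ (t≢r ∘ sym))) (≢-rel x₀x₁′ x₀y (arc≢ (t≢r ∘ sym)))
                 (op x₁v) (op x₁′v) (op yv)

          x₁′x₂ : Arc r x₁′ x₂
          x₁′x₂ with common x₁′x₁
          ... | y , x₁′y , x₁y with third v≢x₂ x₁v x₁x₂ x₁y
          ...   | inj₁ refl = ⊥-elim (¬x₁′v x₁′y)
          ...   | inj₂ refl = x₁′y

          -- Both `r`-successors of `x₀` lead to `x₂`, and the other continuation of each has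
          -- relation `D` from `x₀`.
          d-thin : rel x₀ x₂ ≡ d → Thin d
          d-thin x₀x₂ = thin-at only
            where
            from : ∀ {y w} → Arc r x₀ y → Arc r y x₂ → Arc r y w → rel x₀ w ≡ d → w ≡ x₂
            from x₀y yx₂ yw x₀w with next² D∈ x₀y
            ... | v′ , yv′ , x₀v′ with third (≢-rel x₀x₂ x₀v′ (λ ())) yx₂ yv′ yw
            ...   | inj₁ e = e
            ...   | inj₂ refl = contradiction (trans (sym x₀w) x₀v′) λ ()
            only : ∀ {w} → rel x₀ w ≡ d → w ≡ x₂
            only x₀w with mid² (x₀ , x₁ , x₂ , x₀x₁ , x₁x₂ , x₀x₂) x₀w
            ... | y , x₀y , yw with third x₁≢x₁′ x₀x₁ x₀x₁′ x₀y
            ...   | inj₁ refl = from x₀x₁ x₁x₂ yw x₀w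
            ...   | inj₂ refl = from x₀x₁′ x₁′x₂ yw x₀w

          tt-square : Arc c x₀ x₂ → Sq t c
          tt-square x₀x₂ with st x₁x₂
          ... | y , x₁y , yx₂ with third (u≢x₁′ ∘ sym) (s-sym x₁′x₁) (s-sym ux₁) x₁y
          ...   | inj₁ refl = ⊥-elim (t≢r (arc-inj yx₂ x₁′x₂))
          ...   | inj₂ refl = x₀ , u , x₂ , x₀u , yx₂ , x₀x₂

          far-absurd : ⊥
          far-absurd with square-class x₀x₁ x₁x₂ x₂x₀
          ... | inj₁ (cl , x₀x₂) = x₁≢x₁′ (pure-square-thin {1 + m} cl (d-thin x₀x₂) x₀x₁ x₀x₁′)
          ... | inj₂ (_ , x₀x₂) = ¬Sq-t (tt-square x₀x₂)

        configuration-absurd : ⊥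
        configuration-absurd with dist v x₀ ≟ 2 + m
        ... | yes e = near e
        ... | no ≢ = Far.far-absurd (toD x₀x₁ x₁v (≤∧≢⇒< vx₀≥ (≢ ∘ sym)) vx₀≤
                       (λ x₀v → Sq-irrefl (s≤s (s≤s z≤n)) (x₀ , x₁ , v , x₀x₁ , x₁v , x₀v)))

      absurd : ⊥
      absurd =
        let x₀ , x₁ , x₂ , x₀x₁ , x₁x₂ , x₂x₀ = on-circuit-pair
            x₁′ , x₀x₁′ , x₁′x₁ = rs x₀x₁
            v , x₁v , vx₂ = rs x₁x₂
            u , x₀u , ux₁ = ts x₀x₁
        in configuration-absurd x₀x₁ x₁x₂ x₂x₀ x₀x₁′ x₁′x₁ x₁v vx₂ x₀u ux₁

    opaque
      sr-≢ : ∀ {x y z} → Arc s x y → Arc r y z → ¬ Arc r x z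
      sr-≢ xy yz xz = CommonTarget.absurd xy yz xz

    opaque
      rs-≢ : ∀ {x y z} → Arc r x y → Arc s y z → ¬ Arc r x z
      rs-≢ xy yz xz = let y′ , a , b = comm xy yz in sr-≢ a b xz

    opaque
      -- Both `r` `s` and `r` `t` span `D`, so in the splitting of `(y , z)` into `t` and `s` the
      -- leading `t` can be exchanged for `s` at the cost of a new middle vertex `y′`.
      detour : ∀ {x y z} → Arc r x y → Arc r y z → dist z x ≤ 2 + m →
               ∃ λ y′ → y′ ≢ y × Arc r x y′ × ∃ λ h → Arc s y′ h × Arc s h z
      detour {x} {y} {z} xy yz zx with ts yz | st yz
      ... | h , yh , hz | k , yk , kz
        with mid (rs-D xy yk (≤-trans (dist-arc x kz) (s≤s zx)) (rs-≢ xy yk))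
                 (rt-D xy yh (≤-trans (dist-arc x hz) (s≤s zx))) xy yk
      ... | y′ , xy′ , y′h = y′ , ≢-rel′ y′h yh (arc≢ s≢t) , xy′ , h , y′h , hz

    opaque
      detour-at : ∀ {x y z y′} → Arc r x y → Arc r y z → dist z x ≤ 2 + m → Arc r x y′ → y′ ≢ y →
                  ∃ λ h → Arc s y′ h × Arc s h z
      detour-at xy yz zx xy′ y′≢y with detour xy yz zx
      ... | y″ , y″≢y , xy″ , h , p , q with third (y″≢y ∘ sym) xy xy″ xy′
      ...   | inj₁ e = ⊥-elim (y′≢y e)
      ...   | inj₂ refl = h , p , q

    opaque
      detour-≢ : ∀ {x y z y′} → Arc r x y → Arc r y z → dist z x ≤ 2 + m → Arc r x y′ → y′ ≢ y → ¬ Arc r y′ z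
      detour-≢ xy yz zx xy′ y′≢y y′z = let h , p , q = detour-at xy yz zx xy′ y′≢y in ¬Sq-s (_ , h , _ , p , q , y′z)

    opaque
      rr-second : ∀ {x y} → Arc r x y → ∃ λ z → z ≢ y × Arc r x z
      rr-second {x} {y} xy =
        let a , b , e , ab , be , ea = on-circuit-pair
            b′ , b′≢b , ab′ , _ = detour ab be (≤-reflexive ea)
        in another {y = x} {c = y} (b′≢b ∘ sym) ab ab′

    opaque
      D-mid-s : ∀ {x z} → rel x z ≡ D → ∃ λ y → Arc s x y × Arc r y z
      D-mid-s xz =
        let a , b , e , ab , be , ea = on-circuit-pair
            h , ah , hb = ts ab
        in mid (sr-D hb be (≤-trans (dist-arc′ e ah) (s≤s (≤-reflexive ea))) (sr-≢ hb be)) xz hb be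

    opaque
      -- The target already has two `r`-predecessors, one reached from `x` by type `s` and one by
      -- type `t`.
      D-first : ∀ {k x y z} → k ≢ s → k ≢ t → Arc k x y → Arc r y z → rel x z ≢ D
      D-first k≢s k≢t xy yz xz =
        let a , xa , az = D-mid-s xz
            b , xb , bz = D-mid-t xz
        in three (≢-rel xy xa (arc≢ k≢s)) (≢-rel xy xb (arc≢ k≢t)) (≢-rel xa xb (arc≢ s≢t)) (op yz) (op az) (op bz)

    -- A second successor `z` of `x₁` returns to `x₀` in `2 + m` or `3 + m` steps. The latter puts a
    -- composite `r` `r` into `D`; the former lets the second successor of `x₀` reach `x₂` by an
    -- arc, against `detour-≢`.
    all-r-absurd : AllR → ⊥
    all-r-absurd (x₀ , x₁ , x₀x₁ , x₂ , x₁x₂ , x₃ , x₂x₃ , v) = go (rr-second x₁x₂)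
      where
      x₃x₀ : dist x₃ x₀ ≤ 1 + m
      x₃x₀ = ≤-trans (W-length (replicate (1 + m) r) v) (≤-reflexive (length-replicate (1 + m)))
      x₂x₀ : dist x₂ x₀ ≤ 2 + m
      x₂x₀ = ≤-trans (dist-arc x₀ x₂x₃) (s≤s x₃x₀)
      x₃x₁ : dist x₃ x₁ ≤ 2 + m
      x₃x₁ = ≤-trans (dist-arc′ x₃ x₀x₁) (s≤s x₃x₀)
      go : (∃ λ z → z ≢ x₂ × Arc r x₁ z) → ⊥
      go (z , z≢x₂ , x₁z) = by-dist (dist z x₀ ≟ 2 + m)
        where
        zx₀≥ : 2 + m ≤ dist z x₀
        zx₀≥ = s≤s⁻¹ (back≥ x₀x₁ (fwd x₁z))
        zx₀≤ : dist z x₀ ≤ 3 + m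
        zx₀≤ = let h , p , q = detour-at x₁x₂ x₂x₃ x₃x₁ x₁z z≢x₂
               in ≤-trans (triangle z x₃ x₀) (+-mono-≤ (dist≤2 p q) x₃x₀)
        by-dist : Dec (dist z x₀ ≡ 2 + m) → ⊥
        by-dist (no ≢) = D-first (s≢r ∘ sym) (t≢r ∘ sym) x₀x₁ x₁z
          (toD x₀x₁ x₁z (≤∧≢⇒< zx₀≥ (≢ ∘ sym)) zx₀≤
            (λ x₀z → Sq-irrefl (s≤s (s≤s z≤n)) (x₀ , x₁ , z , x₀x₁ , x₁z , x₀z)))
        by-dist (yes e) =
          let x₁′ , x₁′≢x₁ , x₀x₁′ = rr-second x₀x₁
              x₂x₀≡ = ≤-antisym x₂x₀ (s≤s⁻¹ (back≥ x₀x₁ (fwd x₁x₂)))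
              _ , x₁′x₂ = share-succ x₀x₁ x₀x₁′ z≢x₂ x₁z x₁x₂ refl (sym (square-unique x₀x₁ x₁z e x₀x₁ x₁x₂ x₂x₀≡))
          in detour-≢ x₀x₁ x₁x₂ x₂x₀ x₀x₁′ x₁′≢x₁ x₁′x₂

    cr-circuit : ∀ {x y z} → Sq r c → Arc c x y → Arc r y z → dist z x ≡ 2 + m → rel x z ≡ d
    cr-circuit {x} {y} {z} sq xy yz zx with geodesic (2 + m) zx
    ... | N , len , v with good (c ∷ N) (cong suc len) (Cl-perm (swap c r ↭.refl) (x , y , xy , z , yz , v))
    ...   | pure (e ∷ _) = ⊥-elim (c≢r e)
    ...   | mixed π _ with ∈-resp-↭ (↭-sym π) (here refl)
    ...     | here e = ⊥-elim (c≢r (sym e))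
    ...     | there r∈N = cong₂ _,_ (fwd-exact (cong suc len) r∈N xy yz v) zx

    -- The comparison of `all-r-absurd` with an arc of type `c` in front. At return distance
    -- `2 + m`, either `c` is thin and `z` leads to `x₃`, or a second `c`-successor of `x₀` shares
    -- the successors of `x₁`; both contradict `detour-≢`.
    mix-absurd : Mix → ⊥
    mix-absurd (sq , cl) = start (Cl-perm (↭.trans (prep r (swap r c ↭.refl)) (swap r c ↭.refl)) cl)
      where
      module At {x₀ x₁ x₂ x₃ z} (x₀x₁ : Arc c x₀ x₁) (x₁x₂ : Arc r x₁ x₂) (x₂x₃ : Arc r x₂ x₃)
                (v : W (replicate (1 + m) c) x₃ x₀) (z≢x₂ : z ≢ x₂) (x₁z : Arc r x₁ z) where
        x₃x₀ : dist x₃ x₀ ≤ 1 + m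
        x₃x₀ = ≤-trans (W-length (replicate (1 + m) c) v) (≤-reflexive (length-replicate (1 + m)))
        x₃x₁ : dist x₃ x₁ ≤ 2 + m
        x₃x₁ = ≤-trans (dist-arc′ x₃ x₀x₁) (s≤s x₃x₀)
        zx₀≥ : 2 + m ≤ dist z x₀
        zx₀≥ = s≤s⁻¹ (back≥′ (fwd x₀x₁) x₁z)
        zx₀≤ : dist z x₀ ≤ 3 + m
        zx₀≤ = let h , p , q = detour-at x₁x₂ x₂x₃ x₃x₁ x₁z z≢x₂
               in ≤-trans (triangle z x₃ x₀) (+-mono-≤ (dist≤2 p q) x₃x₀)
        x₂x₀ : dist x₂ x₀ ≡ 2 + m
        x₂x₀ = ≤-antisym (≤-trans (dist-arc x₀ x₂x₃) (s≤s x₃x₀)) (s≤s⁻¹ (back≥′ (fwd x₀x₁) x₁x₂))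
        ¬x₀z : ¬ Arc r x₀ z
        ¬x₀z x₀z = contradiction (trans (sym (fwd x₀x₁)) (trans (dist-symIn x₀z x₁z) (bwd x₀x₁))) λ ()
        x₁x₃ : Arc c x₁ x₃
        x₁x₃ = square-arc (length-replicate (1 + m)) (replicate⁺ (2 + m) c≢r) x₁x₂ x₂x₃
          (subst (λ k → W (replicate k c) x₃ x₁) (+-comm (1 + m) 1) (W-replicate (1 + m) 1 v (x₁ , x₀x₁ , refl)))
        thin-absurd : Thin (1 , c) → ⊥
        thin-absurd th with next² sq x₁z
        ... | u , zu , x₁u with th x₁u x₁x₃
        ...   | refl = detour-≢ x₁x₂ x₂x₃ x₃x₁ x₁z z≢x₂ zu
        second-absurd : rel x₀ z ≡ rel x₀ x₂ → (∃ λ x₁′ → x₁′ ≢ x₁ × Arc c x₀ x₁′) → ⊥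
        second-absurd e (x₁′ , x₁′≢x₁ , x₀x₁′) =
          let x₁′z , x₁′x₂ = share-succ x₀x₁ x₀x₁′ z≢x₂ x₁z x₁x₂ refl (sym e)
              y , yx₁ , yx₁′ = commonIn x₁x₂ x₁′x₂
              u , x₁u , yu = next² sq yx₁
          in detour-≢ yx₁ x₁u (≤-reflexive (bwd yu)) yx₁′ x₁′≢x₁
               ([ (λ e → subst (Arc r x₁′) (sym e) x₁′z) , (λ e → subst (Arc r x₁′) (sym e) x₁′x₂) ]′
                (third z≢x₂ x₁z x₁x₂ x₁u))
        dichotomy : rel x₀ z ≡ rel x₀ x₂ → Dec (∃ λ x₁′ → x₁′ ≢ x₁ × Arc c x₀ x₁′) → ⊥
        dichotomy e (yes p) = second-absurd e p
        dichotomy e (no ¬p) = thin-absurd (thin-at unique)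
          where
          unique : ∀ {w} → Arc c x₀ w → w ≡ x₁
          unique {w} x₀w with w Fin.≟ x₁
          ... | yes e = e
          ... | no w≢x₁ = ⊥-elim (¬p (w , w≢x₁ , x₀w))
        by-dist : Dec (dist z x₀ ≡ 2 + m) → ⊥
        by-dist (no ≢) = D-first (λ e → <⇒≢ s<c (sym e)) (t≢c sq ∘ sym) x₀x₁ x₁z
          (toD x₀x₁ x₁z (≤∧≢⇒< zx₀≥ (≢ ∘ sym)) zx₀≤ ¬x₀z)
        by-dist (yes e) = dichotomy (trans (cr-circuit sq x₀x₁ x₁z e) (sym (cr-circuit sq x₀x₁ x₁x₂ x₂x₀)))
          (any? λ x₁′ → ¬? (x₁′ Fin.≟ x₁) ×-dec (rel x₀ x₁′ ≟ᴿ (1 , c)))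
      start : Cl (c ∷ r ∷ r ∷ replicate (1 + m) c) → ⊥
      start (x₀ , x₁ , x₀x₁ , x₂ , x₁x₂ , x₃ , x₂x₃ , v) =
        let z , z≢x₂ , x₁z = rr-second x₁x₂
        in At.by-dist x₀x₁ x₁x₂ x₂x₃ v z≢x₂ x₁z (dist z x₀ ≟ 2 + m)

    absurd : ⊥
    absurd = [ all-r-absurd , mix-absurd ]′ kind

  -- If `t > r`, the return path of `(x , y)` closes a circuit of `t + 1` arcs, on which `s` can
  -- only be `t - 1 = r`, and then `y` and `z` are symmetric. If `t = r`, the tails `x` and `z` are
  -- symmetric.
  product-types : ∀ {r s t x y z} → 2 ≤ r → s < t → Arc s x z → Arc t z y → Arc r x y → s ≡ 1 × t ≡ r
  product-types {r} {s} {t} {x} {y} {z} 2≤r s<t xz zy xy = by-order (<-cmp t r)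
    where
    1≤t : 1 ≤ t
    1≤t = arc-≥1 zy
    above : r < t → ⊥
    above r<t with geodesic r (bwd xy)
    ... | N , len , v with ≤-antisym (Cl-length {l = s ∷ N} (Cl-perm (swap s t ↭.refl) (x , z , xz , y , zy , v))) (≤-trans (≤-reflexive (cong suc len)) r<t)
    ...   | t≡ = types (good-all 1≤t (s ∷ N) (sym t≡) (Cl-perm (swap s t ↭.refl) (x , z , xz , y , zy , v)))
      where
      types : Circuit t (s ∷ N) → ⊥
      types cc with circuit-types cc
      ... | inj₁ e ∷ _ = <⇒≢ s<t e
      ... | inj₂ e ∷ _ with suc-injective (trans e (trans t≡ (cong suc len)))
      ...   | refl = <⇒≢ (<-trans 2≤r r<t) (sym (trans (sym (bwd zy)) (trans (sym (dist-symOut xz xy)) (fwd zy))))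
    by-order : Tri (t < r) (t ≡ r) (r < t) → s ≡ 1 × t ≡ r
    by-order (tri≈ _ refl _) = trans (sym (bwd xz)) (trans (sym (dist-symIn xy zy)) (fwd xz)) , refl
    by-order (tri> _ _ r<t) = ⊥-elim (above r<t)
    by-order (tri< t<r _ _) = ⊥-elim (below r t<r xy)
      where
      below : ∀ r → t < r → Arc r x y → ⊥
      below (suc zero) (s≤s t<) _ = contradiction (≤-trans 1≤t t<) λ ()
      below (suc (suc zero)) (s≤s t<) _ = <⇒≱ (≤-<-trans (arc-≥1 xz) s<t) t<
      below (suc (suc (suc m))) t<r xy = ThreeTypes.absurd (arc-≥1 xz) s<t t<r xz zy xy

-- Circuits of the digraph and closed walks

toℕ-next : ∀ {m} (i : Fin (suc m)) → toℕ i < m → toℕ (next i) ≡ suc (toℕ i)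
toℕ-next {m} i i<m with suc (toℕ i) <? suc m
... | yes p = toℕ-fromℕ< p
... | no ¬p = contradiction (s≤s i<m) ¬p

next-last : ∀ {m} (i : Fin (suc m)) → toℕ i ≡ m → next i ≡ zero
next-last {m} i e with suc (toℕ i) <? suc m
... | yes p = contradiction p (<-irrefl (cong suc e))
... | no _  = refl

module SchemeCircuits (S : Scheme) where
  open ArcProducts S public

  -- For the scheme of a digraph Γ these are definitionally IsCircuit Γ and Pure Γ.
  IsCircuitˢ : ∀ {m} → (Fin (suc m) → Vertex) → Set
  IsCircuitˢ w = Injective _≡_ _≡_ w × (∀ i → dist (w i) (w (next i)) ≡ 1)

  Pureˢ : ℕ → Set
  Pureˢ r = ∀ u v → dist u v ≡ 1 → dist v u ≡ r →
            (w : Fin (suc r) → Vertex) → IsCircuitˢ w → (∃ λ i → w i ≡ u × w (next i) ≡ v) →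
            ∀ i → dist (w (next i)) (w i) ≡ r

  Sq? : ∀ r s → Dec (Sq r s)
  Sq? r s = any? λ x → any? λ y → any? λ z →
    (rel x y ≟ᴿ (1 , r)) ×-dec (rel y z ≟ᴿ (1 , r)) ×-dec (rel x z ≟ᴿ (1 , s))

  module _ {m : ℕ} (w : Fin (suc m) → Vertex) (arcs : ∀ i → dist (w i) (w (next i)) ≡ 1) where

    arc-type : Fin (suc m) → ℕ
    arc-type i = dist (w (next i)) (w i)

    arc-types : ∀ j (i : Fin (suc m)) → toℕ i + j ≡ m →
                ∃ λ L → length L ≡ suc j × W L (w i) (w zero) × (∀ i′ → toℕ i ≤ toℕ i′ → arc-type i′ ∈ L)
    arc-types zero i e =
      arc-type i ∷ [] , refl , (w (next i) , arc (arcs i) , cong w (next-last i i≡m)) ,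
      λ i′ le → here (cong arc-type (toℕ-injective (≤-antisym
        (≤-trans (s≤s⁻¹ (toℕ<n i′)) (≤-reflexive (sym i≡m))) le)))
      where
      i≡m : toℕ i ≡ m
      i≡m = trans (sym (+-identityʳ (toℕ i))) e
    arc-types (suc j) i e with toℕ-next i (≤-trans (m≤m+n (suc (toℕ i)) j) (≤-reflexive (trans (sym (+-suc (toℕ i) j)) e)))
    ... | e₁ with arc-types j (next i) (trans (cong (_+ j) e₁) (trans (sym (+-suc (toℕ i) j)) e))
    ...   | L , len , v , all = arc-type i ∷ L , cong suc len , (w (next i) , arc (arcs i) , v) , all′
      where
      all′ : ∀ i′ → toℕ i ≤ toℕ i′ → arc-type i′ ∈ arc-type i ∷ L
      all′ i′ le with m≤n⇒m<n∨m≡n le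
      ... | inj₁ lt = there (all i′ (≤-trans (≤-reflexive e₁) lt))
      ... | inj₂ eq = here (cong arc-type (toℕ-injective (sym eq)))

  Pureᶜ⇒Pure : ∀ {r} → Pureᶜ r → Pureˢ r
  Pureᶜ⇒Pure {r} p u v uv vu w (_ , arcs) (i₀ , refl , refl) i =
    let L , len , walk , all = arc-types w arcs r zero refl
        M , π = bring (subst (_∈ L) vu (all i₀ z≤n))
        pM = p M (suc-injective (trans (sym (↭-length π)) len)) (Cl-perm π (w zero , walk))
    in All.lookup (All-resp-↭ (↭-sym π) (refl ∷ pM)) (all i z≤n)

  -- The circuit x, z, y, …, x whose arcs from y on all have type 1 + k.
  module MixedCircuit {k : ℕ} {x z : Vertex} (xz : Arc (2 + k) x z) (s : ℕ → Vertex) (zs : Arc (2 + k) z (s 0))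
                      (step : ∀ i → i < 1 + k → Arc (1 + k) (s i) (s (suc i)))
                      (s≡x : s (1 + k) ≡ x) (ret : rel (s 0) (s (1 + k)) ≡ (1 + k , 1)) where
    open ReturnPath s step ret

    h : ℕ → Vertex
    h zero          = x
    h (suc zero)    = z
    h (suc (suc i)) = s i

    h-arc : ∀ j → j < 3 + k → dist (h j) (h (suc j)) ≡ 1
    h-arc zero          _ = fwd xz
    h-arc (suc zero)    _ = fwd zs
    h-arc (suc (suc i)) (s≤s (s≤s i<)) = fwd (step i i<)

    -- From index 1 on the distance to `x` drops by exactly one per step; distinctness of the
    -- vertices is read off from this.
    h-dist : ∀ j → suc j < 3 + k → dist (h (suc j)) x + suc j ≡ 3 + k
    h-dist zero    _ = trans (cong (_+ 1) (bwd xz)) (+-comm (2 + k) 1)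
    h-dist (suc i) (s≤s (s≤s i<)) with m≤n⇒∃[o]m+o≡n (<⇒≤ i<)
    ... | o , e = trans (+-suc _ (suc i)) (cong suc (trans (+-suc _ i) (cong suc
          (trans (cong (_+ i) (subst (λ v → dist (s i) v ≡ o) end (geo o i 0 o+i))) o+i))))
      where
      o+i : o + i ≡ 1 + k
      o+i = trans (+-comm o i) e
      end : s (o + i) ≡ x
      end = trans (cong s o+i) s≡x

    w : Fin (3 + k) → Vertex
    w i = h (toℕ i)

    w-next : ∀ i → w (next i) ≡ h (suc (toℕ i))
    w-next i with m≤n⇒m<n∨m≡n (s≤s⁻¹ (toℕ<n i))
    ... | inj₁ lt = cong h (toℕ-next i lt)
    -- `h` extends one index past `w`: `h (3 + k)` is `s (1 + k)`, that is `x`, and closes the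
    -- circuit.
    ... | inj₂ e  = trans (cong w (next-last i e)) (trans (sym s≡x) (cong (λ j → h (suc j)) (sym e)))

    h-injective : ∀ i j → i < 3 + k → j < 3 + k → h i ≡ h j → i ≡ j
    h-injective zero    zero    _ _ _ = refl
    h-injective zero    (suc j) _ j< e = contradiction
      (trans (sym (h-dist j j<)) (cong (_+ suc j) (trans (cong (λ v → dist v x) (sym e)) (dist-refl x)))) (<⇒≢ j< ∘ sym)
    h-injective (suc i) zero    i< _ e = contradiction
      (trans (sym (h-dist i i<)) (cong (_+ suc i) (trans (cong (λ v → dist v x) e) (dist-refl x)))) (<⇒≢ i< ∘ sym)
    h-injective (suc i) (suc j) i< j< e = +-cancelˡ-≡ (dist (h (suc i)) x) _ _
      (trans (h-dist i i<) (trans (sym (h-dist j j<)) (cong (λ v → dist v x + suc j) (sym e))))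

    circuit : IsCircuitˢ w
    circuit = (λ {i} {j} e → toℕ-injective (h-injective (toℕ i) (toℕ j) (toℕ<n i) (toℕ<n j) e)) ,
              λ i → trans (cong (dist (w i)) (w-next i)) (h-arc (toℕ i) (toℕ<n i))

    impure : ¬ Pureˢ (2 + k)
    impure p = 1+n≢n (trans (sym (p x z (fwd xz) (bwd xz) w circuit (zero , refl , w-next zero) third-arc))
                     (trans (cong (λ v → dist v (s 0)) (w-next third-arc)) (bwd (step 0 (s≤s z≤n)))))
      where
      third-arc : Fin (3 + k)
      third-arc = suc (suc zero)

  Sq⇒impure : ∀ {k} → Sq (2 + k) (1 + k) → ¬ Pureˢ (2 + k)
  Sq⇒impure {k} sq@(x , z , y , xz , zy , xy) with vertices (1 + k) (pure-cycle (square-pureᶜ sq) xy)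
  ... | s , refl , s≡x , step = MixedCircuit.impure xz s zy step s≡x
          (subst (λ v → rel (s 0) v ≡ (1 + k , 1)) (sym s≡x) (op xy))

  -- A negated purity yields no witness; the decision procedure `Sq?` supplies it, since without
  -- `Sq` every circuit of this type is pure.
  impure⇒Sq : ∀ {k} → ¬ Pureˢ (2 + k) → Sq (2 + k) (1 + k)
  impure⇒Sq {k} mix with Sq? (2 + k) (1 + k)
  ... | yes sq = sq
  ... | no ¬sq = contradiction (Pureᶜ⇒Pure pureᶜ) mix
    where
    pureᶜ : Pureᶜ (2 + k)
    pureᶜ N len cl with good-all (s≤s z≤n) N len cl
    ... | pure a = a
    ... | mixed _ sq = ⊥-elim (¬sq sq)

  square-index : ∀ {k s} → Sq (2 + k) (s ∸ 1) → s ≡ 2 + k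
  -- Truncated subtraction reads index 0 as type 0, which no arc has.
  square-index {s = zero}  (_ , _ , _ , _ , _ , a) = contradiction (arc-≥1 a) λ ()
  square-index {s = suc s} sq = cong suc (square-type sq)

  product-index : ∀ {k s t x y z} → s < t → Arc (s ∸ 1) x z → Arc (t ∸ 1) z y → Arc (2 + k) x y → s ≡ 2 × t ≡ 3 + k
  product-index {s = zero} s<t xz zy xy = contradiction (arc-≥1 xz) λ ()
  product-index {s = suc s} {suc t} s<t xz zy xy =
    let s≡ , t≡ = product-types (s≤s (s≤s z≤n)) (s≤s⁻¹ s<t) xz zy xy
    in cong suc s≡ , cong suc t≡

-- Nonzero intersection numbers as triangles

module Counts (Γ : Digraph) (wdr : WeaklyDistanceRegular Γ)
                       (com : Commutative Γ) (qt : QuasiThin Γ) where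
  open Regularity Γ wdr com qt using (mid⁺; mid⁻)

  Triangle : ℕ × ℕ → ℕ × ℕ → ℕ × ℕ → Set
  Triangle h i j = ∃ λ x → ∃ λ y → ∃ λ z → ∂̃ Γ x y ≡ h × ∂̃ Γ x z ≡ i × ∂̃ Γ z y ≡ j

  nonzero⁺ : ∀ {h i j} → Triangle h i j → PNonzero Γ h i j
  nonzero⁺ {h} {i} {j} (x , y , z , xy , xz , zy) =
    (x , z , xz) , (z , y , zy) , x , y , xy ,
    count≥1 (λ z → (∂̃ Γ x z =ᵖ i) ∧ (∂̃ Γ z y =ᵖ j)) z (mid⁺ {x} {y} {z} xz zy)

  nonzero⁻ : ∀ {h i j} → PNonzero Γ h i j → Triangle h i j
  nonzero⁻ {h} {i} {j} (_ , _ , x , y , xy , pos)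
    with count≥1⁻ (λ z → (∂̃ Γ x z =ᵖ i) ∧ (∂̃ Γ z y =ᵖ j)) pos
  ... | z , t with mid⁻ {x} {y} {z} t
  ...   | xz , zy = x , y , z , xy , xz , zy

theorem2p1 : (Γ : Digraph) → WeaklyDistanceRegular Γ → Commutative Γ → QuasiThin Γ →
    (∀ x → 3 < valency Γ x) →
    (q : ℕ) → 3 ≤ q → InD Γ (1 , q ∸ 1) →
    (∀ s t → InD Γ (1 , s ∸ 1) → InD Γ (1 , t ∸ 1) → s < t →
    PNonzero Γ (1 , q ∸ 1) (1 , s ∸ 1) (1 , t ∸ 1) → s ≡ 2 × t ≡ q)
    × ((Mixed Γ (q ∸ 1) ⇔
    (PNonzero Γ (1 , q ∸ 2) (1 , q ∸ 1) (1 , q ∸ 1) × InD Γ (1 , q ∸ 2) × Pure Γ (q ∸ 2)))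
    × (Mixed Γ (q ∸ 1) ⇔
    (∃ λ s → InD Γ (1 , s ∸ 1) × PNonzero Γ (1 , s ∸ 1) (1 , q ∸ 1) (1 , q ∸ 1))))
    × (∀ s → PNonzero Γ (1 , s ∸ 1) (1 , q ∸ 1) (1 , q ∸ 1) → s ≡ q ∸ 1)
theorem2p1 Γ wdr com qt _ (suc (suc (suc k))) (s≤s (s≤s (s≤s _))) _ =
    (λ s t _ _ s<t nz → let x , y , z , xy , xz , zy = nonzero⁻ nz in product-index {s = s} {t} s<t xz zy xy)
  , ( mk⇔ (λ mix → let sq = impure⇒Sq mix
                   in nonzero sq , target sq , Pureᶜ⇒Pure (square-pureᶜ sq))
          (λ (nz , _) → Sq⇒impure (square nz))
    , mk⇔ (λ mix → 2 + k , target (impure⇒Sq mix) , nonzero (impure⇒Sq mix))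
          (λ (s , _ , nz) → Sq⇒impure
             (subst (λ s → Sq (2 + k) (s ∸ 1)) (square-index {s = s} (square nz)) (square nz))) )
  , (λ s nz → square-index {s = s} (square nz))
  where
  open SchemeCircuits (toScheme Γ wdr com qt)
    using (Sq; square-pureᶜ; Pureᶜ⇒Pure; Sq⇒impure; impure⇒Sq; square-index; product-index)
  open Counts Γ wdr com qt
  square : ∀ {r s} → PNonzero Γ (1 , s) (1 , r) (1 , r) → Sq r s
  square nz = let x , y , z , xy , xz , zy = nonzero⁻ nz in x , z , y , xz , zy , xy
  nonzero : ∀ {r s} → Sq r s → PNonzero Γ (1 , s) (1 , r) (1 , r)
  nonzero (x , z , y , xz , zy , xy) = nonzero⁺ (x , y , z , xy , xz , zy)
  target : ∀ {r s} → Sq r s → InD Γ (1 , s)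
  target (x , _ , y , _ , _ , xy) = x , y , xy
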